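{- Let $n\ge 4$ and $J_n=Jac(Y(n;1,1,1))$. Then (1) if $n$ is odd, $J_n\cong \mathbb{Z}_3^{\,n-4}\oplus\mathbb{Z}_{3n}\oplus\mathbb{Z}_{L_n}^2\oplus\mathbb{Z}_{3L_n}^2$; (2) if $n$ is even, $J_n\cong \mathbb{Z}_3^{\,n-4}\oplus\mathbb{Z}_{3n}\oplus\mathbb{Z}_{F_n}\oplus\mathbb{Z}_{3F_n}\oplus\mathbb{Z}_{5F_n}\oplus\mathbb{Z}_{15F_n}$, where $F_n$ and $L_n$ are the Fibonacci and Lucas numbers.
   Context: $F_0=0,F_1=1,F_{n+1}=F_n+F_{n-1}$; $L_0=2,L_1=1,L_{n+1}=L_n+L_{n-1}$. $\mathbb{Z}_d$ denotes the cyclic group of order $d$. Let $T$ be the $n\times n$ cyclic shift permutation matrix ($T_{i,i+1}=1$, indices mod $n$). The graph $Y(n;1,1,1)$ has vertices $v_{x,y}$, $x\in\{0,1,2,3\}$, $y\in\mathbb{Z}_n$, and edges $v_{i,y}v_{i,y+1}$ and $v_{i,y}v_{0,y}$ for $i=1,2,3$, $y\in\mathbb{Z}_n$. Its Laplacian (degree matrix minus adjacency matrix), with vertices ordered by $x$, is the block matrix $L$ with first block row $(3I_n,-I_n,-I_n,-I_n)$ and, for $i=1,2,3$, block row $i$ having $-I_n$ in block column $0$, $3I_n-T-T^{ -1}$ in block column $i$ and zeros elsewhere. The Jacobian group $Jac(G)$ of the graph is the torsion subgroup of $\operatorname{coker}(L)=\mathbb{Z}^{4n}/L\mathbb{Z}^{4n}$.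 -}

module Defs where

open import Data.Nat as ℕ using (ℕ; zero; suc; NonZero; _∸_; _≤_)
open import Data.Nat.DivMod using (_%_; m%n<n)
open import Data.Fin as Fin using (Fin; zero; suc; toℕ; fromℕ<)
open import Data.Integer as ℤ using (ℤ; +_; _+_; _-_; _*_; -_)
open import Data.Integer.Divisibility using (_∣_)
open import Data.List using (List; []; _∷_; _++_; replicate; length; lookup)
open import Data.Product using (Σ; _×_; _,_; proj₁)
open import Relation.Binary.PropositionalEquality using (_≡_)

F : ℕ → ℕ
F zero = 0
F (suc zero) = 1
F (suc (suc n)) = F (suc n) ℕ.+ F n

Luc : ℕ → ℕ
Luc zero = 2
Luc (suc zero) = 1
Luc (suc (suc n)) = Luc (suc n) ℕ.+ Luc n

next : ∀ {n} .{{_ : NonZero n}} → Fin n → Fin n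
next {n} y = fromℕ< (m%n<n (suc (toℕ y)) n)

prev : ∀ {n} .{{_ : NonZero n}} → Fin n → Fin n
prev {n} y = fromℕ< (m%n<n (toℕ y ℕ.+ (n ∸ 1)) n)

-- integer vectors indexed by the vertices v_{x,y}, x ∈ Fin 4, y ∈ Fin n
C : ℕ → Set
C n = Fin 4 → Fin n → ℤ

-- the Laplacian L of Y(n;1,1,1) acting on ℤ^{4n} (block form of the paper):
-- block row 0 : (3I, -I, -I, -I)
-- block row i : -I in column 0, 3I - T - T⁻¹ in column i  (i = 1,2,3)
-- where (T z)_y = z_{y+1}
lap : ∀ {n} .{{_ : NonZero n}} → C n → C n
lap z zero y = + 3 * z zero y - z (suc zero) y - z (suc (suc zero)) y - z (suc (suc (suc zero))) y
lap z (suc i) y = - z zero y + + 3 * z (suc i) y - z (suc i) (next y) - z (suc i) (prev y)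

InImage : ∀ n .{{_ : NonZero n}} → C n → Set
InImage n x = Σ (C n) λ z → ∀ i y → lap z i y ≡ x i y

CokerEq : ∀ n .{{_ : NonZero n}} → C n → C n → Set
CokerEq n x x' = InImage n (λ i y → x i y - x' i y)

IsTorsion : ∀ n .{{_ : NonZero n}} → C n → Set
IsTorsion n x = Σ ℕ λ k → (1 ≤ k) × InImage n (λ i y → + k * x i y)

-- carrier of Jac(Y(n;1,1,1)) (representatives; equality is CokerEq)
Jac : ∀ n .{{_ : NonZero n}} → Set
Jac n = Σ (C n) (IsTorsion n)

-- the group ℤ_{d₁} ⊕ … ⊕ ℤ_{d_k}, for ds = d₁ ∷ … ∷ d_k, as ℤ^k with
-- componentwise congruence modulo dᵢ
CycSum : List ℕ → Set
CycSum ds = Fin (length ds) → ℤ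

CycEq : (ds : List ℕ) → CycSum ds → CycSum ds → Set
CycEq ds a b = ∀ i → (+ lookup ds i) ∣ (a i - b i)

record JacIso (n : ℕ) .{{_ : NonZero n}} (ds : List ℕ) : Set where
  field
    f : Jac n → CycSum ds
    well-defined : ∀ a b → CokerEq n (proj₁ a) (proj₁ b) → CycEq ds (f a) (f b)
    homomorphism : ∀ a b c → (∀ i y → proj₁ c i y ≡ proj₁ a i y + proj₁ b i y) →
                   CycEq ds (f c) (λ i → f a i + f b i)
    injective : ∀ a b → CycEq ds (f a) (f b) → CokerEq n (proj₁ a) (proj₁ b)
    surjective : ∀ t → Σ (Jac n) λ a → CycEq ds (f a) t

oddFactors : ℕ → List ℕ
oddFactors n = replicate (n ∸ 4) 3 ++ (3 ℕ.* n ∷ Luc n ∷ Luc n ∷ 3 ℕ.* Luc n ∷ 3 ℕ.* Luc n ∷ [])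

evenFactors : ℕ → List ℕ
evenFactors n = replicate (n ∸ 4) 3 ++ (3 ℕ.* n ∷ F n ∷ 3 ℕ.* F n ∷ 5 ℕ.* F n ∷ 15 ℕ.* F n ∷ [])

{-# OPTIONS --safe #-}
module Submission where

-- Let R = ℤ[T]/(Tⁿ - 1) and W c = c - T - T⁻¹. Eliminating the relations e₀ = W₃ eᵢ and
-- e₁ + e₂ + e₃ = 3 e₀ splits the cokernel of the Laplacian as R/(W₃) ⊕ R/(3 W₃ W₂), generated by
-- e₂ - e₁ and e₁. A solution basis s, t of the recurrence a(y+1) = c a(y) - a(y-1) gives the
-- coordinates (Σ s_y x_y , Σ t_y x_y) on R/(W c): F(2y) and L(2y-1) for c = 3, y and 1 for c = 2.
-- As W₃ - W₂ = 1, R/(W₃ W₂) = R/(W₃) ⊕ R/(W₂); the remaining factor 3 multiplies the moduli of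
-- these four coordinates by 3, and the entries x_y with y ≥ 4 give n - 4 further coordinates mod 3.
-- The modulus 0 of the coordinate Σ x_y is the free part, so torsion means that it vanishes.

open import Defs
open import Data.Nat as ℕ using (ℕ; zero; suc; NonZero; _≤_; z≤n; s≤s)
import Data.Nat.Properties as ℕₚ
open import Data.Nat.DivMod
  using (_%_; %-distribˡ-+; m%n%n≡m%n; [m+n]%n≡m%n; m<n⇒m%n≡m; n%n≡0; m≡m%n+[m/n]*n; _/_)
open import Data.Fin using (Fin; zero; suc; toℕ)
open import Data.Fin.Properties using (toℕ-injective; toℕ-fromℕ<; toℕ<n; _≟_)
open import Data.Fin.Patterns using (0F; 1F; 2F; 3F; 4F)
open import Data.Fin.Permutation using (Permutation; permutation)
open import Data.Integer as ℤ using (ℤ; +_; -[1+_]; _+_; _-_; _*_; -_; 0ℤ; 1ℤ; -1ℤ)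
open import Data.Integer.Properties as ℤₚ using (+-*-semiring)
open import Data.Integer.Divisibility.Signed
open import Data.Integer.Tactic.RingSolver using (solve-∀)
open import Data.Bool using (if_then_else_)
open import Data.List using (List; []; _∷_; _++_; replicate; length; lookup)
open import Data.Nat.Divisibility as ℕ∣ using (m∣m*n; n∣m*n)
open import Data.Product using (Σ; _×_; _,_; proj₁; proj₂)
open import Data.Sum using (_⊎_; inj₁; inj₂; [_,_]′)
open import Data.Empty using (⊥-elim)
open import Relation.Nullary using (yes; no; does)
open import Relation.Binary.PropositionalEquality
  using (_≡_; refl; sym; trans; cong; cong₂; subst; module ≡-Reasoning)
open import Algebra.Properties.Semiring.Sum +-*-semiring
  using (sum; sum-cong-≗; sum-permute; ∑-distrib-+; *-distribˡ-sum)

open ≡-Reasoning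

-- Substituting e₃ = 3 W₃ e₁ - e₁ - e₂ into the last relation W₃ e₃ = W₃ e₁ gives 3 W₃ (W₃ - 1) e₁ =
-- W₃ (e₂ - e₁), and the right side is 0 because W₃ e₁ = e₀ = W₃ e₂. Since W₃ - 1 = W₂, this is the
-- relation 3 W₃ W₂ e₁ = 0. The obstacle is the factor 3: it may divide the other moduli, so it
-- cannot be split off as a coprime part. A vector lies in 3 W₃ W₂ R exactly when 3 divides all its
-- entries and its third lies in W₃ W₂ R. Tripled moduli express the second condition, but they also
-- yield four linear congruences modulo 3 on the entries. Up to a power of T, W₃ W₂ is a monic
-- quartic, and the values of its four solution sequences at 0, 1, 2, 3 form a unimodular matrix.
-- The four congruences therefore account for the four lowest entries, and only the other n - 4
-- entries need coordinates of their own.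

*-pad : ∀ a v → a * v ≡ a * v + 0ℤ * v
*-pad = solve-∀

-- The cyclic shift of indices

toℕ-next : ∀ {m} (y : Fin (suc m)) → toℕ (next y) ≡ suc (toℕ y) % suc m
toℕ-next y = toℕ-fromℕ< _

toℕ-prev : ∀ {m} (y : Fin (suc m)) → toℕ (prev y) ≡ (toℕ y ℕ.+ m) % suc m
toℕ-prev y = toℕ-fromℕ< _

suc-% : ∀ a m → suc (a % suc m) % suc m ≡ suc a % suc m
suc-% a m = begin
  suc (a % suc m) % suc m                         ≡⟨ %-distribˡ-+ 1 (a % suc m) (suc m) ⟩
  (1 % suc m ℕ.+ (a % suc m) % suc m) % suc m     ≡⟨ cong (λ r → (1 % suc m ℕ.+ r) % suc m) (m%n%n≡m%n a (suc m)) ⟩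
  (1 % suc m ℕ.+ a % suc m) % suc m               ≡⟨ %-distribˡ-+ 1 a (suc m) ⟨
  suc a % suc m                                   ∎

next-prev : ∀ {m} (y : Fin (suc m)) → next (prev y) ≡ y
next-prev {m} y = toℕ-injective (begin
  toℕ (next (prev y))                       ≡⟨ toℕ-next (prev y) ⟩
  suc (toℕ (prev y)) % suc m                ≡⟨ cong (λ r → suc r % suc m) (toℕ-prev y) ⟩
  suc ((toℕ y ℕ.+ m) % suc m) % suc m       ≡⟨ suc-% (toℕ y ℕ.+ m) m ⟩
  suc (toℕ y ℕ.+ m) % suc m                 ≡⟨ cong (_% suc m) (ℕₚ.+-suc (toℕ y) m) ⟨
  (toℕ y ℕ.+ suc m) % suc m                 ≡⟨ [m+n]%n≡m%n (toℕ y) (suc m) ⟩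
  toℕ y % suc m                             ≡⟨ m<n⇒m%n≡m (toℕ<n y) ⟩
  toℕ y                                     ∎)

prev-next : ∀ {m} (y : Fin (suc m)) → prev (next y) ≡ y
prev-next {m} y = toℕ-injective (begin
  toℕ (prev (next y))                              ≡⟨ toℕ-prev (next y) ⟩
  (toℕ (next y) ℕ.+ m) % suc m                     ≡⟨ cong (λ r → (r ℕ.+ m) % suc m) (toℕ-next y) ⟩
  (suc (toℕ y) % suc m ℕ.+ m) % suc m              ≡⟨ %-distribˡ-+ (suc (toℕ y) % suc m) m (suc m) ⟩
  ((suc (toℕ y) % suc m) % suc m ℕ.+ m % suc m) % suc m
    ≡⟨ cong (λ r → (r ℕ.+ m % suc m) % suc m) (m%n%n≡m%n (suc (toℕ y)) (suc m)) ⟩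
  (suc (toℕ y) % suc m ℕ.+ m % suc m) % suc m      ≡⟨ %-distribˡ-+ (suc (toℕ y)) m (suc m) ⟨
  (suc (toℕ y) ℕ.+ m) % suc m                      ≡⟨ cong (_% suc m) (ℕₚ.+-suc (toℕ y) m) ⟨
  (toℕ y ℕ.+ suc m) % suc m                        ≡⟨ [m+n]%n≡m%n (toℕ y) (suc m) ⟩
  toℕ y % suc m                                    ≡⟨ m<n⇒m%n≡m (toℕ<n y) ⟩
  toℕ y                                            ∎)

rotation : ∀ {m} → Permutation (suc m) (suc m)
rotation = permutation prev next prev-next next-prev

-- Iterating `next`, rather than reducing modulo n, makes `residue (suc a)` the shift of `residue a`
-- by computation, so that an induction on a follows the powers of T past the wrap-around.
residue : ∀ {m} → ℕ → Fin (suc m)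
residue zero    = zero
residue (suc a) = next (residue a)

toℕ-residue : ∀ {m} a → toℕ (residue {m} a) ≡ a % suc m
toℕ-residue         zero    = refl
toℕ-residue {m} (suc a) = begin
  toℕ (next (residue {m} a))      ≡⟨ toℕ-next (residue a) ⟩
  suc (toℕ (residue {m} a)) % suc m   ≡⟨ cong (λ r → suc r % suc m) (toℕ-residue a) ⟩
  suc (a % suc m) % suc m         ≡⟨ suc-% a m ⟩
  suc a % suc m                   ∎

residue-toℕ : ∀ {m} (y : Fin (suc m)) → residue (toℕ y) ≡ y
residue-toℕ y = toℕ-injective (trans (toℕ-residue (toℕ y)) (m<n⇒m%n≡m (toℕ<n y)))

residue-period : ∀ {m} → residue {m} (suc m) ≡ zero
residue-period {m} = toℕ-injective (trans (toℕ-residue (suc m)) (n%n≡0 (suc m)))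

-- The pairing of integer vectors and the standard basis

infix 8 _•_

_•_ : ∀ {n} → (Fin n → ℤ) → (Fin n → ℤ) → ℤ
u • v = sum (λ y → u y * v y)

sum-linear : ∀ {n} a b (f g : Fin n → ℤ) →
  sum (λ y → a * f y + b * g y) ≡ a * sum f + b * sum g
sum-linear a b f g = trans (∑-distrib-+ (λ y → a * f y) (λ y → b * g y))
  (cong₂ _+_ (sym (*-distribˡ-sum a f)) (sym (*-distribˡ-sum b g)))

•-linear : ∀ {n} a b (u v w : Fin n → ℤ) {x : Fin n → ℤ} →
  (∀ y → x y ≡ a * v y + b * w y) → u • x ≡ a * u • v + b * u • w
•-linear a b u v w x≗ = trans
  (sum-cong-≗ (λ y → trans (cong (u y *_) (x≗ y)) (shuffle (u y) (v y) (w y) a b)))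
  (sum-linear a b (λ y → u y * v y) (λ y → u y * w y))
  where
  shuffle : ∀ u v w a b → u * (a * v + b * w) ≡ a * (u * v) + b * (u * w)
  shuffle = solve-∀

•-scale : ∀ {n} a (u v : Fin n → ℤ) {x : Fin n → ℤ} →
  (∀ y → x y ≡ a * v y) → u • x ≡ a * u • v
•-scale a u v x≗ = trans
  (•-linear a 0ℤ u v v (λ y → trans (x≗ y) (*-pad a (v y))))
  (sym (*-pad a (u • v)))

•-cong : ∀ {n} (u : Fin n → ℤ) {v w : Fin n → ℤ} → (∀ y → v y ≡ w y) → u • v ≡ u • w
•-cong u v≗w = sum-cong-≗ (λ y → cong (u y *_) (v≗w y))

∣-sum : ∀ {n d} (f : Fin n → ℤ) → (∀ y → d ∣ f y) → d ∣ sum f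
∣-sum {zero}  f d∣f = ∣n⇒∣m*n 0ℤ ∣-refl
∣-sum {suc n} f d∣f = ∣m∣n⇒∣m+n (d∣f zero) (∣-sum (λ y → f (suc y)) (λ y → d∣f (suc y)))

∣-•ʳ : ∀ {n d} (u v : Fin n → ℤ) → (∀ y → d ∣ v y) → d ∣ u • v
∣-•ʳ u v d∣v = ∣-sum (λ y → u y * v y) (λ y → ∣n⇒∣m*n (u y) (d∣v y))

∣-•ˡ : ∀ {n d} (u v : Fin n → ℤ) → (∀ y → d ∣ u y) → d ∣ u • v
∣-•ˡ u v d∣u = ∣-sum (λ y → u y * v y) (λ y → ∣m⇒∣m*n (v y) (d∣u y))

δ : ∀ {n} → Fin n → Fin n → ℤ
δ x y = if does (x ≟ y) then 1ℤ else 0ℤ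

δ-⇔ : ∀ {n} {x y x′ y′ : Fin n} → (x ≡ y → x′ ≡ y′) → (x′ ≡ y′ → x ≡ y) → δ x y ≡ δ x′ y′
δ-⇔ {x = x} {y} {x′} {y′} to from with x ≟ y | x′ ≟ y′
... | yes _ | yes _ = refl
... | no _  | no _  = refl
... | yes p | no ¬q = ⊥-elim (¬q (to p))
... | no ¬p | yes q = ⊥-elim (¬p (from q))

δ-next-next : ∀ {m} (x y : Fin (suc m)) → δ (next x) (next y) ≡ δ x y
δ-next-next x y = δ-⇔
  (λ eq → trans (sym (prev-next x)) (trans (cong prev eq) (prev-next y))) (cong next)

δ-prev : ∀ {m} (x y : Fin (suc m)) → δ x (prev y) ≡ δ (next x) y
δ-prev x y = δ-⇔
  (λ eq → trans (cong next eq) (next-prev y)) (λ eq → trans (sym (prev-next x)) (cong prev eq))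

sum-δ : ∀ {n} (x : Fin n → ℤ) y → sum (λ j → x j * δ j y) ≡ x y
sum-δ {suc n} x zero = begin
  x zero * 1ℤ + sum (λ j → x (suc j) * 0ℤ)   ≡⟨ cong (_+ sum (λ j → x (suc j) * 0ℤ)) (ℤₚ.*-identityʳ (x zero)) ⟩
  x zero + sum (λ j → x (suc j) * 0ℤ)        ≡⟨ cong (λ r → x zero + r) (•-scale 0ℤ (λ j → x (suc j)) (λ _ → 0ℤ) (λ _ → refl)) ⟩
  x zero + 0ℤ                                ≡⟨ ℤₚ.+-identityʳ (x zero) ⟩
  x zero                                     ∎
sum-δ {suc n} x (suc y) = begin
  x zero * 0ℤ + sum (λ j → x (suc j) * δ j y)   ≡⟨ cong₂ _+_ (ℤₚ.*-zeroʳ (x zero)) (sum-δ (λ j → x (suc j)) y) ⟩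
  0ℤ + x (suc y)                                ≡⟨ ℤₚ.+-identityˡ (x (suc y)) ⟩
  x (suc y)                                     ∎

-- The operators c - T - T⁻¹ and their images

W : ∀ {m} → ℤ → (Fin (suc m) → ℤ) → Fin (suc m) → ℤ
W c v y = c * v y - v (next y) - v (prev y)

W-linear : ∀ {m} c a b (v w : Fin (suc m) → ℤ) {x : Fin (suc m) → ℤ} →
  (∀ y → x y ≡ a * v y + b * w y) → ∀ y → W c x y ≡ a * W c v y + b * W c w y
W-linear c a b v w {x} x≗ y
  rewrite x≗ y | x≗ (next y) | x≗ (prev y) =
    shuffle c a b (v y) (v (next y)) (v (prev y)) (w y) (w (next y)) (w (prev y))
  where
  shuffle : ∀ c a b v v⁺ v⁻ w w⁺ w⁻ →
    c * (a * v + b * w) - (a * v⁺ + b * w⁺) - (a * v⁻ + b * w⁻) ≡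
    a * (c * v - v⁺ - v⁻) + b * (c * w - w⁺ - w⁻)
  shuffle = solve-∀

-- The two integrands differ by `h y - h (prev y)` for the discrete Wronskian `h`, and the sum of
-- `h` is invariant under rotation.
W-self-adjoint : ∀ {m} c (u v : Fin (suc m) → ℤ) → u • W c v ≡ W c u • v
W-self-adjoint c u v = begin
  sum (λ y → u y * W c v y)
    ≡⟨ sum-cong-≗ pointwise ⟩
  sum (λ y → 1ℤ * (W c u y * v y) + 1ℤ * (1ℤ * h y + -1ℤ * h (prev y)))
    ≡⟨ sum-linear 1ℤ 1ℤ (λ y → W c u y * v y) (λ y → 1ℤ * h y + -1ℤ * h (prev y)) ⟩
  1ℤ * W c u • v + 1ℤ * sum (λ y → 1ℤ * h y + -1ℤ * h (prev y))
    ≡⟨ cong (λ r → 1ℤ * W c u • v + 1ℤ * r) (sum-linear 1ℤ -1ℤ h (λ y → h (prev y))) ⟩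
  1ℤ * W c u • v + 1ℤ * (1ℤ * sum h + -1ℤ * sum (λ y → h (prev y)))
    ≡⟨ cong (λ r → 1ℤ * W c u • v + 1ℤ * (1ℤ * r + -1ℤ * sum (λ y → h (prev y)))) (sum-permute h rotation) ⟩
  1ℤ * W c u • v + 1ℤ * (1ℤ * sum (λ y → h (prev y)) + -1ℤ * sum (λ y → h (prev y)))
    ≡⟨ cancel (W c u • v) (sum (λ y → h (prev y))) ⟩
  W c u • v ∎
  where
  h : _ → ℤ
  h y = u (next y) * v y - u y * v (next y)

  shuffle : ∀ c u u⁺ u⁻ v v⁺ v⁻ →
    u * (c * v - v⁺ - v⁻) ≡
    1ℤ * ((c * u - u⁺ - u⁻) * v) + 1ℤ * (1ℤ * (u⁺ * v - u * v⁺) + -1ℤ * (u * v⁻ - u⁻ * v))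
  shuffle = solve-∀

  pointwise : ∀ y → u y * W c v y ≡ 1ℤ * (W c u y * v y) + 1ℤ * (1ℤ * h y + -1ℤ * h (prev y))
  pointwise y rewrite next-prev y = shuffle c (u y) (u (next y)) (u (prev y)) (v y) (v (next y)) (v (prev y))

  cancel : ∀ a b → 1ℤ * a + 1ℤ * (1ℤ * b + -1ℤ * b) ≡ a
  cancel = solve-∀

record InW {m : ℕ} (c : ℤ) (x : Fin (suc m) → ℤ) : Set where
  constructor _,_
  field
    source : Fin (suc m) → ℤ
    image  : ∀ y → W c source y ≡ x y

InW-linear : ∀ {m c} a b {v w x : Fin (suc m) → ℤ} → InW c v → InW c w →
  (∀ y → x y ≡ a * v y + b * w y) → InW c x
InW-linear {c = c} a b (zv , v≗) (zw , w≗) x≗ = (λ y → a * zv y + b * zw y) , λ y →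
  trans (W-linear c a b zv zw (λ _ → refl) y)
        (trans (cong₂ (λ r s → a * r + b * s) (v≗ y) (w≗ y)) (sym (x≗ y)))

InW-scale : ∀ {m c} a {v x : Fin (suc m) → ℤ} → InW c v → (∀ y → x y ≡ a * v y) → InW c x
InW-scale a {v} v∈ x≗ = InW-linear a 0ℤ v∈ v∈ (λ y → trans (x≗ y) (*-pad a (v y)))

InW-sum : ∀ {m c l} (a : Fin l → ℤ) (V : Fin l → Fin (suc m) → ℤ) →
  (∀ j → InW c (V j)) → InW c (λ y → sum (λ j → a j * V j y))
InW-sum {c = c} {zero} a V V∈ = (λ _ → 0ℤ) , λ _ → zero-shift c
  where
  zero-shift : ∀ c → c * 0ℤ - 0ℤ - 0ℤ ≡ 0ℤ
  zero-shift = solve-∀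
InW-sum {l = suc l} a V V∈ = InW-linear (a zero) 1ℤ (V∈ zero)
  (InW-sum (λ j → a (suc j)) (λ j → V (suc j)) (λ j → V∈ (suc j)))
  (λ y → cong (λ r → a zero * V zero y + r) (sym (ℤₚ.*-identityˡ _)))

-- The cokernel of W c from periodic solutions of its recurrence

Recurrent : ℤ → (ℕ → ℤ) → Set
Recurrent c s = ∀ a → s (suc (suc a)) ≡ c * s (suc a) - s a

-- For a basis s, t of the solutions of s(a+2) = c s(a+1) - s(a), the matrix of
-- (shift by n) - 1 factors as a unimodular matrix times diag(d, e); hence
-- coker (W c) ≅ ℤ/d ⊕ ℤ/e via x ↦ (s • x , t • x).
record Diagonalisation (c : ℤ) (n : ℕ) (s t : ℕ → ℤ) (d e : ℤ) : Set where
  field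
    s-rec : Recurrent c s
    t-rec : Recurrent c t
    s0 : s 0 ≡ 0ℤ
    s1 : s 1 ≡ 1ℤ
    t0 : t 0 * t 0 ≡ 1ℤ
    α β γ ω : ℤ
    s-period₀ : s n ≡ s 0 + α * d
    t-period₀ : t n ≡ t 0 + β * e
    s-period₁ : s (suc n) ≡ s 1 + γ * d
    t-period₁ : t (suc n) ≡ t 1 + ω * e
    unimodular : α * ω - β * γ ≡ -1ℤ

on : ∀ {n} → (ℕ → ℤ) → Fin n → ℤ
on s y = s (toℕ y)

recurrent-period : ∀ {c d n} (s : ℕ → ℤ) → Recurrent c s →
  d ∣ s n - s 0 → d ∣ s (suc n) - s 1 → ∀ a → d ∣ s (a ℕ.+ n) - s a
recurrent-period {c} {d} {n} s s-rec d₀ d₁ a = proj₁ (both a)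
  where
  shuffle : ∀ c x y z w → (c * y - x) - (c * w - z) ≡ c * (y - w) - (x - z)
  shuffle = solve-∀

  both : ∀ a → d ∣ s (a ℕ.+ n) - s a × d ∣ s (suc a ℕ.+ n) - s (suc a)
  both zero = d₀ , d₁
  both (suc a) with both a
  ... | da , da₁ = da₁ , subst (d ∣_)
    (sym (trans (cong₂ _-_ (s-rec (a ℕ.+ n)) (s-rec a)) (shuffle c _ (s (suc a ℕ.+ n)) (s a) _)))
    (∣m∣n⇒∣m-n (∣n⇒∣m*n c da₁) da)

periodic-* : ∀ {d n} (s : ℕ → ℤ) → (∀ a → d ∣ s (a ℕ.+ n) - s a) →
  ∀ q a → d ∣ s (a ℕ.+ q ℕ.* n) - s a
periodic-* {d} {n} s per zero a = subst (λ r → d ∣ s r - s a) (sym (ℕₚ.+-identityʳ a))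
  (subst (d ∣_) (sym (ℤₚ.+-inverseʳ (s a))) (divides 0ℤ refl))
periodic-* {d} {n} s per (suc q) a = subst (d ∣_)
  (telescope (s (a ℕ.+ suc q ℕ.* n)) (s (a ℕ.+ n)) (s a))
  (∣m∣n⇒∣m+n
    (subst (λ r → d ∣ s r - s (a ℕ.+ n)) (ℕₚ.+-assoc a n (q ℕ.* n)) (periodic-* s per q (a ℕ.+ n)))
    (per a))
  where
  telescope : ∀ x y z → (x - y) + (y - z) ≡ x - z
  telescope = solve-∀

periodic-% : ∀ {d m} (s : ℕ → ℤ) → (∀ a → d ∣ s (a ℕ.+ suc m) - s a) →
  ∀ a → d ∣ s a - s (a % suc m)
periodic-% {d} {m} s per a = subst (λ r → d ∣ s r - s (a % suc m))
  (sym (m≡m%n+[m/n]*n a (suc m))) (periodic-* s per (a / suc m) (a % suc m))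

-- On the cycle, `next` and `prev` reduce their indices, which costs a multiple of `d` each. The
-- predecessor of a is represented by a + m instead of a - 1, so the recurrence is applied one
-- period higher, where it produces the value at a + 1 + n.
W-periodic : ∀ {c d m} (s : ℕ → ℤ) → Recurrent c s → (∀ a → d ∣ s (a ℕ.+ suc m) - s a) →
  ∀ (y : Fin (suc m)) → d ∣ W c (on s) y
W-periodic {c} {d} {m} s s-rec per y = subst (d ∣_) eq
  (∣m∣n⇒∣m+n
    (∣m∣n⇒∣m+n (periodic-% s per (suc a)) (periodic-% s per (a ℕ.+ m)))
    (∣m∣n⇒∣m-n (per (suc a)) (∣n⇒∣m*n c (per a))))
  where
  a : ℕ
  a = toℕ y

  telescope : ∀ c r r₁ x x₁ x₂ u v →
    ((r₁ - u) + (x - v)) + ((c * x₁ - x - r₁) - c * (x₁ - r)) ≡ c * r - u - v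
  telescope = solve-∀

  recurrence : s (suc a ℕ.+ suc m) ≡ c * s (a ℕ.+ suc m) - s (a ℕ.+ m)
  recurrence = subst (λ r → s (suc r) ≡ c * s r - s (a ℕ.+ m))
    (sym (ℕₚ.+-suc a m)) (s-rec (a ℕ.+ m))

  eq : (s (suc a) - s (suc a % suc m)) + (s (a ℕ.+ m) - s ((a ℕ.+ m) % suc m))
     + ((s (suc a ℕ.+ suc m) - s (suc a)) - c * (s (a ℕ.+ suc m) - s a))
     ≡ W c (on s) y
  eq = begin
    (s (suc a) - s (suc a % suc m)) + (s (a ℕ.+ m) - s ((a ℕ.+ m) % suc m))
     + ((s (suc a ℕ.+ suc m) - s (suc a)) - c * (s (a ℕ.+ suc m) - s a))
      ≡⟨ cong (λ r → (s (suc a) - s (suc a % suc m)) + (s (a ℕ.+ m) - s ((a ℕ.+ m) % suc m))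
           + ((r - s (suc a)) - c * (s (a ℕ.+ suc m) - s a))) recurrence ⟩
    (s (suc a) - s (suc a % suc m)) + (s (a ℕ.+ m) - s ((a ℕ.+ m) % suc m))
     + ((c * s (a ℕ.+ suc m) - s (a ℕ.+ m) - s (suc a)) - c * (s (a ℕ.+ suc m) - s a))
      ≡⟨ telescope c (s a) (s (suc a)) (s (a ℕ.+ m)) (s (a ℕ.+ suc m)) 0ℤ
           (s (suc a % suc m)) (s ((a ℕ.+ m) % suc m)) ⟩
    c * s a - s (suc a % suc m) - s ((a ℕ.+ m) % suc m)
      ≡⟨ cong₂ (λ u v → c * s a - s u - s v) (sym (toℕ-next y)) (sym (toℕ-prev y)) ⟩
    W c (on s) y ∎

module _ {c d e : ℤ} {m : ℕ} {s t : ℕ → ℤ} (Δ : Diagonalisation c (suc m) s t d e) where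
  open Diagonalisation Δ

  private
    difference : ∀ x y z → x ≡ y + z → x - y ≡ z
    difference x y z refl = lemma y z
      where
      lemma : ∀ y z → y + z - y ≡ z
      lemma = solve-∀

    -- `g` and `h` are dual to `s` and `t`: they solve `s a * g + t a * h` = `δ (residue a)` for a =
    -- 0, 1. As `s 0` is 0 and `s 1` is 1, this only takes the inverse of `t 0`, which is `t 0`
    -- itself.
    g h : Fin (suc m) → ℤ
    h y = t 0 * δ (residue 0) y
    g y = δ (residue 1) y - t 1 * h y

  s-annihilates : ∀ y → d ∣ W c (on {suc m} s) y
  s-annihilates = W-periodic {c} s s-rec (recurrent-period {c} s s-rec
    (divides α (difference (s (suc m)) (s 0) (α * d) s-period₀))
    (divides γ (difference (s (suc (suc m))) (s 1) (γ * d) s-period₁)))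

  t-annihilates : ∀ y → e ∣ W c (on {suc m} t) y
  t-annihilates = W-periodic {c} t t-rec (recurrent-period {c} t t-rec
    (divides β (difference (t (suc m)) (t 0) (β * e) t-period₀))
    (divides ω (difference (t (suc (suc m))) (t 1) (ω * e) t-period₁)))

  -- Modulo the image of `W c`, the powers of T obey the same recurrence as `s` and `t`, so both
  -- expressions agree for all a once they agree at 0 and 1. The index a is not bounded by n, which
  -- is what makes the relations below available.
  residue-mod : ∀ a → InW c (λ y → δ (residue a) y - (s a * g y + t a * h y))
  residue-mod a = proj₁ (both a)
    where
    base₀ : ∀ y → δ (residue 0) y - (s 0 * g y + t 0 * h y) ≡ 0ℤ
    base₀ y = begin
      δ (residue 0) y - (s 0 * g y + t 0 * h y)
        ≡⟨ cong (λ r → δ (residue 0) y - (r * g y + t 0 * h y)) s0 ⟩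
      δ (residue 0) y - (0ℤ * g y + t 0 * (t 0 * δ (residue 0) y))
        ≡⟨ square (δ (residue 0) y) (g y) (t 0) ⟩
      (1ℤ - t 0 * t 0) * δ (residue 0) y
        ≡⟨ cong (λ r → (1ℤ - r) * δ (residue 0) y) t0 ⟩
      0ℤ ∎
      where
      square : ∀ x g t → x - (0ℤ * g + t * (t * x)) ≡ (1ℤ - t * t) * x
      square = solve-∀

    base₁ : ∀ y → δ (residue 1) y - (s 1 * g y + t 1 * h y) ≡ 0ℤ
    base₁ y = trans (cong (λ r → δ (residue 1) y - (r * g y + t 1 * h y)) s1)
      (cancel (δ (residue 1) y) (t 1 * h y))
      where
      cancel : ∀ x u → x - (1ℤ * (x - u) + u) ≡ 0ℤ
      cancel = solve-∀

    0∈ : ∀ {x : Fin (suc m) → ℤ} → (∀ y → x y ≡ 0ℤ) → InW c x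
    0∈ x≗ = InW-scale 0ℤ (δ (residue a) , λ _ → refl) x≗

    δ-recurrence : ∀ a y → W c (δ (residue (suc a))) y ≡
      c * δ (residue (suc a)) y - δ (residue a) y - δ (residue (suc (suc a))) y
    δ-recurrence a y = cong₂ (λ u v → c * δ (residue (suc a)) y - u - v)
      (δ-next-next (residue a) y) (δ-prev (residue (suc a)) y)

    shuffle : ∀ c x x₁ x₂ g h s s₁ t t₁ →
      x₂ - ((c * s₁ - s) * g + (c * t₁ - t) * h) ≡
      1ℤ * (c * (x₁ - (s₁ * g + t₁ * h)) + -1ℤ * (x - (s * g + t * h)))
      + -1ℤ * (c * x₁ - x - x₂)
    shuffle = solve-∀

    both : ∀ a → InW c (λ y → δ (residue a) y - (s a * g y + t a * h y))
               × InW c (λ y → δ (residue (suc a)) y - (s (suc a) * g y + t (suc a) * h y))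
    both zero = 0∈ base₀ , 0∈ base₁
    both (suc a) with both a
    ... | p , p₁ = p₁ , InW-linear 1ℤ -1ℤ
      (InW-linear c -1ℤ p₁ p (λ _ → refl)) (δ (residue (suc a)) , δ-recurrence a)
      (λ y → trans
        (cong₂ (λ u v → δ (residue (suc (suc a))) y - (u * g y + v * h y)) (s-rec a) (t-rec a))
        (shuffle c (δ (residue a) y) (δ (residue (suc a)) y) (δ (residue (suc (suc a))) y)
          (g y) (h y) (s a) (s (suc a)) (t a) (t (suc a))))

  private
    -- One basis vector is expressed in two ways, by indices a and b with the same residue;
    -- subtracting leaves a relation between `d * g` and `e * h`.
    closing : ∀ {α β} a b → residue {m} b ≡ residue a →
      s b ≡ s a + α * d → t b ≡ t a + β * e →
      InW c (λ y → α * d * g y + β * e * h y)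
    closing {α} {β} a b b≡a s-per t-per =
      InW-linear 1ℤ -1ℤ (residue-mod a) (residue-mod b) λ y → begin
        α * d * g y + β * e * h y
          ≡⟨ shuffle (δ (residue a) y) (g y) (h y) (s a) (t a) (α * d) (β * e) ⟩
        1ℤ * (δ (residue a) y - (s a * g y + t a * h y))
        + -1ℤ * (δ (residue a) y - ((s a + α * d) * g y + (t a + β * e) * h y))
          ≡⟨ cong (λ r → 1ℤ * (δ (residue a) y - (s a * g y + t a * h y)) + -1ℤ * r) (sym
               (cong₂ (λ r u → δ r y - u) b≡a (cong₂ (λ u v → u * g y + v * h y) s-per t-per))) ⟩
        1ℤ * (δ (residue a) y - (s a * g y + t a * h y))
        + -1ℤ * (δ (residue b) y - (s b * g y + t b * h y)) ∎
      where
      shuffle : ∀ x g h s t a b → a * g + b * h ≡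
        1ℤ * (x - (s * g + t * h)) + -1ℤ * (x - ((s + a) * g + (t + b) * h))
      shuffle = solve-∀

    relation₀ : InW c (λ y → α * d * g y + β * e * h y)
    relation₀ = closing {α} {β} 0 (suc m) residue-period s-period₀ t-period₀

    relation₁ : InW c (λ y → γ * d * g y + ω * e * h y)
    relation₁ = closing {γ} {ω} 1 (suc (suc m)) (cong next residue-period) s-period₁ t-period₁

    -- Cramer's rule: the two relations have determinant -1, so `d * g`, and likewise `e * h`, is an
    -- integral combination of them.
    dg∈ : InW c (λ y → d * g y)
    dg∈ = InW-linear (- ω) β relation₀ relation₁ λ y → begin
      d * g y                            ≡⟨ negate (d * g y) ⟩
      - -1ℤ * (d * g y)                ≡⟨ cong (λ r → - r * (d * g y)) (sym unimodular) ⟩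
      - (α * ω - β * γ) * (d * g y)      ≡⟨ cramer α β γ ω d e (g y) (h y) ⟩
      - ω * (α * d * g y + β * e * h y) + β * (γ * d * g y + ω * e * h y) ∎
      where
      negate : ∀ x → x ≡ - -1ℤ * x
      negate = solve-∀
      cramer : ∀ α β γ ω d e g h → - (α * ω - β * γ) * (d * g) ≡
        - ω * (α * d * g + β * e * h) + β * (γ * d * g + ω * e * h)
      cramer = solve-∀

    eh∈ : InW c (λ y → e * h y)
    eh∈ = InW-linear γ (- α) relation₀ relation₁ λ y → begin
      e * h y                            ≡⟨ negate (e * h y) ⟩
      - -1ℤ * (e * h y)                ≡⟨ cong (λ r → - r * (e * h y)) (sym unimodular) ⟩
      - (α * ω - β * γ) * (e * h y)      ≡⟨ cramer α β γ ω d e (g y) (h y) ⟩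
      γ * (α * d * g y + β * e * h y) + - α * (γ * d * g y + ω * e * h y) ∎
      where
      negate : ∀ x → x ≡ - -1ℤ * x
      negate = solve-∀
      cramer : ∀ α β γ ω d e g h → - (α * ω - β * γ) * (e * h) ≡
        γ * (α * d * g + β * e * h) + - α * (γ * d * g + ω * e * h)
      cramer = solve-∀

  -- Self-adjointness moves `W c` from the preimage of x to `s` and `t`, which it annihilates modulo
  -- `d` and `e`.
  InW⇒∣ : ∀ {x} → InW c x → d ∣ on s • x × e ∣ on t • x
  InW⇒∣ {x} (z , z≗) = through s s-annihilates , through t t-annihilates
    where
    through : ∀ {f} (r : ℕ → ℤ) → (∀ y → f ∣ W c (on {suc m} r) y) → f ∣ on r • x
    through {f} r f∣ = subst (f ∣_)
      (trans (sym (W-self-adjoint c (on r) z)) (•-cong (on r) z≗)) (∣-•ˡ (W c (on r)) z f∣)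

  -- Expanding x in the standard basis and reducing each basis vector gives x ≡ (s • x) g + (t • x)
  -- h, where both coefficients are multiples of the orders `d` of `g` and `e` of `h`.
  ∣⇒InW : ∀ {x} → d ∣ on s • x → e ∣ on t • x → InW c x
  ∣⇒InW {x} (divides q sx≡) (divides r tx≡) =
    InW-linear 1ℤ 1ℤ
      (InW-sum x (λ j y → δ j y - (s (toℕ j) * g y + t (toℕ j) * h y))
        (λ j → subst (λ i → InW c (λ y → δ i y - (s (toℕ j) * g y + t (toℕ j) * h y)))
          (residue-toℕ j) (residue-mod (toℕ j))))
      (InW-linear q r dg∈ eh∈ (λ _ → refl))
      (λ y → sym (begin
        1ℤ * sum (λ j → x j * (δ j y - (s (toℕ j) * g y + t (toℕ j) * h y)))
        + 1ℤ * (q * (d * g y) + r * (e * h y))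
          ≡⟨ cong (λ u → 1ℤ * u + 1ℤ * (q * (d * g y) + r * (e * h y))) (expand y) ⟩
        1ℤ * (1ℤ * x y + -1ℤ * (g y * on s • x + h y * on t • x))
        + 1ℤ * (q * (d * g y) + r * (e * h y))
          ≡⟨ cong₂ (λ u v → 1ℤ * (1ℤ * x y + -1ℤ * (g y * u + h y * v))
                            + 1ℤ * (q * (d * g y) + r * (e * h y))) sx≡ tx≡ ⟩
        1ℤ * (1ℤ * x y + -1ℤ * (g y * (q * d) + h y * (r * e)))
        + 1ℤ * (q * (d * g y) + r * (e * h y))
          ≡⟨ cancel (x y) (g y) (h y) q r d e ⟩
        x y ∎))
    where
    cancel : ∀ x g h q r d e → 1ℤ * (1ℤ * x + -1ℤ * (g * (q * d) + h * (r * e)))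
        + 1ℤ * (q * (d * g) + r * (e * h)) ≡ x
    cancel = solve-∀

    distribute : ∀ x δ s t g h → x * (δ - (s * g + t * h)) ≡
      1ℤ * (x * δ) + -1ℤ * (g * (s * x) + h * (t * x))
    distribute = solve-∀

    expand : ∀ y → sum (λ j → x j * (δ j y - (s (toℕ j) * g y + t (toℕ j) * h y))) ≡
      1ℤ * x y + -1ℤ * (g y * on s • x + h y * on t • x)
    expand y = begin
      sum (λ j → x j * (δ j y - (s (toℕ j) * g y + t (toℕ j) * h y)))
        ≡⟨ sum-cong-≗ (λ j → distribute (x j) (δ j y) (s (toℕ j)) (t (toℕ j)) (g y) (h y)) ⟩
      sum (λ j → 1ℤ * (x j * δ j y) + -1ℤ * (g y * (s (toℕ j) * x j) + h y * (t (toℕ j) * x j)))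
        ≡⟨ sum-linear 1ℤ -1ℤ (λ j → x j * δ j y)
             (λ j → g y * (s (toℕ j) * x j) + h y * (t (toℕ j) * x j)) ⟩
      1ℤ * sum (λ j → x j * δ j y)
      + -1ℤ * sum (λ j → g y * (s (toℕ j) * x j) + h y * (t (toℕ j) * x j))
        ≡⟨ cong₂ (λ u v → 1ℤ * u + -1ℤ * v) (sum-δ x y)
             (sum-linear (g y) (h y) (λ j → s (toℕ j) * x j) (λ j → t (toℕ j) * x j)) ⟩
      1ℤ * x y + -1ℤ * (g y * on s • x + h y * on t • x) ∎

-- The diagonalisations for c = 2 and c = 3

linear-diagonalisation : ∀ n → Diagonalisation (+ 2) n +_ (λ _ → 1ℤ) (+ n) 0ℤ
linear-diagonalisation n = record
  { s-rec = λ a → second-difference (+ a) ; t-rec = λ _ → refl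
  ; s0 = refl ; s1 = refl ; t0 = refl
  -- The constant solution is exactly periodic, so its modulus is 0 and `β`, `ω` are free; they are
  -- chosen to make the determinant -1.
  ; α = 1ℤ ; β = 1ℤ ; γ = 1ℤ ; ω = 0ℤ
  ; s-period₀ = period₀ (+ n)
  ; t-period₀ = refl
  ; s-period₁ = period₁ (+ n)
  ; t-period₁ = refl
  ; unimodular = refl
  }
  where
  second-difference : ∀ x → + 2 + x ≡ + 2 * (1ℤ + x) - x
  second-difference = solve-∀
  period₀ : ∀ x → x ≡ 0ℤ + 1ℤ * x
  period₀ = solve-∀
  period₁ : ∀ x → 1ℤ + x ≡ 1ℤ + 1ℤ * x
  period₁ = solve-∀

-- A quadratic form with value ±1 at consecutive Fibonacci numbers. Replacing the constants ±1 by it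
-- makes the period conditions homogeneous, hence polynomial identities in F(n) and F(n+1).
cassini : ℕ → ℤ
cassini a = + F (suc a) * + F (suc a) - + F (suc a) * + F a - + F a * + F a

cassini-suc² : ∀ a → cassini (suc (suc a)) ≡ cassini a
cassini-suc² a = lemma (+ F a) (+ F (suc a))
  where
  lemma : ∀ f g →
    (g + f + g) * (g + f + g) - (g + f + g) * (g + f) - (g + f) * (g + f) ≡ g * g - g * f - f * f
  lemma = solve-∀

cassini-even : ∀ n → n % 2 ≡ 0 → cassini n ≡ 1ℤ
cassini-even zero          _    = refl
cassini-even (suc (suc n)) even = trans (cassini-suc² n) (cassini-even n even)

cassini-odd : ∀ n → n % 2 ≡ 1 → cassini n ≡ -1ℤ
cassini-odd (suc zero)    _   = refl
cassini-odd (suc (suc n)) odd = trans (cassini-suc² n) (cassini-odd n odd)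

Luc-F : ∀ a → + Luc a ≡ + 2 * + F (suc a) - + F a
Luc-F a = proj₁ (both a)
  where
  shuffle : ∀ f g → (+ 2 * (g + f) - g) + (+ 2 * g - f) ≡ + 2 * (g + f + g) - (g + f)
  shuffle = solve-∀

  both : ∀ a → + Luc a ≡ + 2 * + F (suc a) - + F a
             × + Luc (suc a) ≡ + 2 * + F (suc (suc a)) - + F (suc a)
  both zero = refl , refl
  both (suc a) with both a
  ... | p , p₁ = p₁ , trans (cong₂ _+_ p₁ p) (shuffle (+ F a) (+ F (suc a)))

-- F(2a), as a quadratic form in F(a) and F(a+1).
F₂ : ℕ → ℤ
F₂ a = + F a * (+ 2 * + F (suc a) - + F a)

-- The Lucas number L(2a-1), as a quadratic form in F(a) and F(a+1).
L₂ : ℕ → ℤ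
L₂ a = + 6 * + F a * + F (suc a) - + 4 * + F a * + F a - + F (suc a) * + F (suc a)

F₂-rec : Recurrent (+ 3) F₂
F₂-rec a = lemma (+ F a) (+ F (suc a))
  where
  lemma : ∀ f g → (g + f) * (+ 2 * (g + f + g) - (g + f)) ≡
    + 3 * (g * (+ 2 * (g + f) - g)) - f * (+ 2 * g - f)
  lemma = solve-∀

L₂-rec : Recurrent (+ 3) L₂
L₂-rec a = lemma (+ F a) (+ F (suc a))
  where
  lemma : ∀ f g →
    + 6 * (g + f) * (g + f + g) - + 4 * (g + f) * (g + f) - (g + f + g) * (g + f + g) ≡
    + 3 * (+ 6 * g * (g + f) - + 4 * g * g - (g + f) * (g + f)) - (+ 6 * f * g - + 4 * f * f - g * g)
  lemma = solve-∀

-- For odd n, F(2n+2y) - F(2y) = L(n) F(n+2y) and L(2n+2y-1) - L(2y-1) = L(n) L(n+2y-1). At y = 0, 1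
-- the cofactors are `α` = F(n), `γ` = F(n+2), `β` = L(n-1), `ω` = L(n+1), written in F(n) and
-- F(n+1).
odd-diagonalisation : ∀ n → n % 2 ≡ 1 → Diagonalisation (+ 3) n F₂ L₂ (+ Luc n) (+ Luc n)
odd-diagonalisation n odd = subst (λ d → Diagonalisation (+ 3) n F₂ L₂ d d) (sym (Luc-F n)) (record
  { s-rec = F₂-rec ; t-rec = L₂-rec
  ; s0 = refl ; s1 = refl ; t0 = refl
  ; α = f ; β = + 3 * f - g ; γ = f + g ; ω = g + + 2 * f
  ; s-period₀ = s₀ f g
  ; t-period₀ = trans (t₀ f g) (cong (_+ (+ 3 * f - g) * (+ 2 * g - f)) N)
  ; s-period₁ = trans (s₁ f g) (cong (λ r → - r + (f + g) * (+ 2 * g - f)) N)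
  ; t-period₁ = trans (t₁ f g) (cong (λ r → - r + (g + + 2 * f) * (+ 2 * g - f)) N)
  ; unimodular = trans (det f g) N
  })
  where
  f g : ℤ
  f = + F n
  g = + F (suc n)
  N : cassini n ≡ -1ℤ
  N = cassini-odd n odd

  s₀ : ∀ f g → f * (+ 2 * g - f) ≡ 0ℤ + f * (+ 2 * g - f)
  s₀ = solve-∀
  t₀ : ∀ f g → + 6 * f * g - + 4 * f * f - g * g ≡
    (g * g - g * f - f * f) + (+ 3 * f - g) * (+ 2 * g - f)
  t₀ = solve-∀
  s₁ : ∀ f g → g * (+ 2 * (g + f) - g) ≡ - (g * g - g * f - f * f) + (f + g) * (+ 2 * g - f)
  s₁ = solve-∀
  t₁ : ∀ f g → + 6 * g * (g + f) - + 4 * g * g - (g + f) * (g + f) ≡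
    - (g * g - g * f - f * f) + (g + + 2 * f) * (+ 2 * g - f)
  t₁ = solve-∀
  det : ∀ f g → f * (g + + 2 * f) - (+ 3 * f - g) * (f + g) ≡ g * g - g * f - f * f
  det = solve-∀

-- For even n, F(2n+2y) - F(2y) = F(n) L(n+2y) and L(2n+2y-1) - L(2y-1) = 5 F(n) F(n+2y-1), with
-- cofactors `α` = L(n), `γ` = L(n+2), `β` = F(n-1), `ω` = F(n+1). The factor 5 is the reason for a
-- Lucas sequence; its indices are odd because L(0) = 2 is not a unit, whereas L(-1) = -1 is.
even-diagonalisation : ∀ n → n % 2 ≡ 0 → Diagonalisation (+ 3) n F₂ L₂ (+ F n) (+ 5 * + F n)
even-diagonalisation n even = record
  { s-rec = F₂-rec ; t-rec = L₂-rec
  ; s0 = refl ; s1 = refl ; t0 = refl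
  ; α = + 2 * g - f ; β = g - f ; γ = + 3 * g + f ; ω = g
  ; s-period₀ = s₀ f g
  ; t-period₀ = trans (t₀ f g) (cong (λ r → - r + (g - f) * (+ 5 * f)) N)
  ; s-period₁ = trans (s₁ f g) (cong (λ r → r + (+ 3 * g + f) * f) N)
  ; t-period₁ = trans (t₁ f g) (cong (λ r → r + g * (+ 5 * f)) N)
  ; unimodular = trans (det f g) (cong -_ N)
  }
  where
  f g : ℤ
  f = + F n
  g = + F (suc n)
  N : cassini n ≡ 1ℤ
  N = cassini-even n even

  s₀ : ∀ f g → f * (+ 2 * g - f) ≡ 0ℤ + (+ 2 * g - f) * f
  s₀ = solve-∀
  t₀ : ∀ f g → + 6 * f * g - + 4 * f * f - g * g ≡
    - (g * g - g * f - f * f) + (g - f) * (+ 5 * f)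
  t₀ = solve-∀
  s₁ : ∀ f g → g * (+ 2 * (g + f) - g) ≡ (g * g - g * f - f * f) + (+ 3 * g + f) * f
  s₁ = solve-∀
  t₁ : ∀ f g → + 6 * g * (g + f) - + 4 * g * g - (g + f) * (g + f) ≡
    (g * g - g * f - f * f) + g * (+ 5 * f)
  t₁ = solve-∀
  det : ∀ f g → (+ 2 * g - f) * g - (g - f) * (+ 3 * g + f) ≡ - (g * g - g * f - f * f)
  det = solve-∀

-- Comaximality of W₂ and W₃

W₂ W₃ : ∀ {m} → (Fin (suc m) → ℤ) → Fin (suc m) → ℤ
W₂ = W (+ 2)
W₃ = W (+ 3)

W-cong : ∀ {m} c {v w : Fin (suc m) → ℤ} → (∀ y → v y ≡ w y) → ∀ y → W c v y ≡ W c w y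
W-cong c v≗w y rewrite v≗w y | v≗w (next y) | v≗w (prev y) = refl

W₃-W₂ : ∀ {m} (v : Fin (suc m) → ℤ) y → W₃ v y ≡ 1ℤ * W₂ v y + 1ℤ * v y
W₃-W₂ v y = lemma (v y) (v (next y)) (v (prev y))
  where
  lemma : ∀ v v⁺ v⁻ → + 3 * v - v⁺ - v⁻ ≡ 1ℤ * (+ 2 * v - v⁺ - v⁻) + 1ℤ * v
  lemma = solve-∀

W₃W₂≗W₂W₃ : ∀ {m} (v : Fin (suc m) → ℤ) y → W₃ (W₂ v) y ≡ W₂ (W₃ v) y
W₃W₂≗W₂W₃ v y = trans (W₃-W₂ (W₂ v) y) (sym (W-linear (+ 2) 1ℤ 1ℤ (W₂ v) v (W₃-W₂ v) y))

-- W₃ and W₂ are comaximal because W₃ - W₂ = 1.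
W₃W₂-surjects : ∀ {m} {x : Fin (suc m) → ℤ} → InW (+ 3) x → InW (+ 2) x →
  Σ (Fin (suc m) → ℤ) λ u → ∀ y → W₃ (W₂ u) y ≡ x y
W₃W₂-surjects {x = x} (p , p≗) (r , r≗) = (λ y → 1ℤ * r y + -1ℤ * p y) , λ y →
  trans (W-cong (+ 3) W₂u≗p y) (p≗ y)
  where
  lemma : ∀ a b → 1ℤ * (1ℤ * a + 1ℤ * b) + -1ℤ * a ≡ b
  lemma = solve-∀

  W₂u≗p : ∀ y → W₂ (λ y → 1ℤ * r y + -1ℤ * p y) y ≡ p y
  W₂u≗p y = begin
    W₂ (λ y → 1ℤ * r y + -1ℤ * p y) y            ≡⟨ W-linear (+ 2) 1ℤ -1ℤ r p (λ _ → refl) y ⟩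
    1ℤ * W₂ r y + -1ℤ * W₂ p y                   ≡⟨ cong (λ a → 1ℤ * a + -1ℤ * W₂ p y)
                                                       (trans (r≗ y) (trans (sym (p≗ y)) (W₃-W₂ p y))) ⟩
    1ℤ * (1ℤ * W₂ p y + 1ℤ * p y) + -1ℤ * W₂ p y   ≡⟨ lemma (W₂ p y) (p y) ⟩
    p y                                              ∎

-- Splitting the cokernel of the Laplacian into branch and stem

record In3W₃W₂ {m : ℕ} (x : Fin (suc m) → ℤ) : Set where
  constructor _,_
  field
    source : Fin (suc m) → ℤ
    image  : ∀ y → + 3 * W₃ (W₂ source) y ≡ x y

-- Modulo the relations, x = branch x · (e₂ - e₁) + stem x · e₁.
branch stem : ∀ {m} → C (suc m) → Fin (suc m) → ℤ
branch x y = x 2F y - x 3F y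
stem x y = W₃ (x 0F) y + x 1F y + x 2F y + (+ 3 * W₃ (x 3F) y - + 2 * x 3F y)

branch-linear : ∀ {m} a b (v w : C (suc m)) {x : C (suc m)} →
  (∀ i y → x i y ≡ a * v i y + b * w i y) → ∀ y → branch x y ≡ a * branch v y + b * branch w y
branch-linear a b v w x≗ y rewrite x≗ 2F y | x≗ 3F y =
  lemma a b (v 2F y) (v 3F y) (w 2F y) (w 3F y)
  where
  lemma : ∀ a b v₂ v₃ w₂ w₃ →
    (a * v₂ + b * w₂) - (a * v₃ + b * w₃) ≡ a * (v₂ - v₃) + b * (w₂ - w₃)
  lemma = solve-∀

stem-linear : ∀ {m} a b (v w : C (suc m)) {x : C (suc m)} →
  (∀ i y → x i y ≡ a * v i y + b * w i y) → ∀ y → stem x y ≡ a * stem v y + b * stem w y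
stem-linear a b v w x≗ y
  rewrite W-linear (+ 3) a b (v 0F) (w 0F) (x≗ 0F) y
        | W-linear (+ 3) a b (v 3F) (w 3F) (x≗ 3F) y
        | x≗ 1F y | x≗ 2F y | x≗ 3F y =
    lemma a b (W₃ (v 0F) y) (v 1F y) (v 2F y) (W₃ (v 3F) y) (v 3F y)
              (W₃ (w 0F) y) (w 1F y) (w 2F y) (W₃ (w 3F) y) (w 3F y)
  where
  lemma : ∀ a b v₀ v₁ v₂ v₃ v₃′ w₀ w₁ w₂ w₃ w₃′ →
    (a * v₀ + b * w₀) + (a * v₁ + b * w₁) + (a * v₂ + b * w₂)
      + (+ 3 * (a * v₃ + b * w₃) - + 2 * (a * v₃′ + b * w₃′)) ≡
    a * (v₀ + v₁ + v₂ + (+ 3 * v₃ - + 2 * v₃′)) + b * (w₀ + w₁ + w₂ + (+ 3 * w₃ - + 2 * w₃′))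
  lemma = solve-∀

lap-suc : ∀ {m} (z : C (suc m)) i y → lap z (suc i) y ≡ 1ℤ * W₃ (z (suc i)) y + -1ℤ * z zero y
lap-suc z i y = lemma (z zero y) (z (suc i) y) (z (suc i) (next y)) (z (suc i) (prev y))
  where
  lemma : ∀ z₀ v v⁺ v⁻ → - z₀ + + 3 * v - v⁺ - v⁻ ≡ 1ℤ * (+ 3 * v - v⁺ - v⁻) + -1ℤ * z₀
  lemma = solve-∀

-- Block rows 2 and 3 of the Laplacian share the term -z₀, which cancels in their difference.
InImage⇒branch : ∀ {m} {x : C (suc m)} → InImage (suc m) x → InW (+ 3) (branch x)
InImage⇒branch {x = x} (z , z≗) = (λ y → 1ℤ * z 2F y + -1ℤ * z 3F y) , λ y → begin
  W₃ (λ y → 1ℤ * z 2F y + -1ℤ * z 3F y) y   ≡⟨ W-linear (+ 3) 1ℤ -1ℤ (z 2F) (z 3F) (λ _ → refl) y ⟩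
  1ℤ * W₃ (z 2F) y + -1ℤ * W₃ (z 3F) y      ≡⟨ lemma (W₃ (z 2F) y) (W₃ (z 3F) y) (z 0F y) ⟩
  (1ℤ * W₃ (z 2F) y + -1ℤ * z 0F y) - (1ℤ * W₃ (z 3F) y + -1ℤ * z 0F y)
    ≡⟨ cong₂ _-_ (trans (sym (lap-suc z 1F y)) (z≗ 2F y)) (trans (sym (lap-suc z 2F y)) (z≗ 3F y)) ⟩
  branch x y                                  ∎
  where
  lemma : ∀ a b z → 1ℤ * a + -1ℤ * b ≡ (1ℤ * a + -1ℤ * z) - (1ℤ * b + -1ℤ * z)
  lemma = solve-∀

-- In the stem of an image vector the contributions of z₀, z₁ and z₂ cancel, and 3 W₃ (W₃ - 1) z₃
-- remains.
InImage⇒stem : ∀ {m} {x : C (suc m)} → InImage (suc m) x → In3W₃W₂ (stem x)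
InImage⇒stem {m} {x} (z , z≗) = z 3F , λ y → begin
  + 3 * W₃ (W₂ (z 3F)) y
    ≡⟨ cong (λ r → + 3 * r) (W-linear (+ 3) 1ℤ -1ℤ (W₃ (z 3F)) (z 3F) W₂≗ y) ⟩
  + 3 * (1ℤ * W₃ (W₃ (z 3F)) y + -1ℤ * W₃ (z 3F) y)
    ≡⟨ lemma (W₃ (z 0F) y) (W₃ (z 1F) y) (W₃ (z 2F) y) (W₃ (z 3F) y) (W₃ (W₃ (z 3F)) y) (z 0F y) ⟩
  (1ℤ * (+ 3 * W₃ (z 0F) y + -1ℤ * W₃ (z 1F) y) + -1ℤ * (1ℤ * W₃ (z 2F) y + 1ℤ * W₃ (z 3F) y))
  + (1ℤ * W₃ (z 1F) y + -1ℤ * z 0F y) + (1ℤ * W₃ (z 2F) y + -1ℤ * z 0F y)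
  + (+ 3 * (1ℤ * W₃ (W₃ (z 3F)) y + -1ℤ * W₃ (z 0F) y)
     - + 2 * (1ℤ * W₃ (z 3F) y + -1ℤ * z 0F y))
    ≡⟨ cong₂ _+_ (cong₂ _+_ (cong₂ _+_ (sym W₃x₀) (sym (x-suc 0F y))) (sym (x-suc 1F y)))
                 (cong₂ (λ u v → + 3 * u - + 2 * v) (sym W₃x₃) (sym (x-suc 2F y))) ⟩
  stem x y ∎
  where
  W₂≗ : ∀ y → W₂ (z 3F) y ≡ 1ℤ * W₃ (z 3F) y + -1ℤ * z 3F y
  W₂≗ y = sym (trans (cong (λ r → 1ℤ * r + -1ℤ * z 3F y) (W₃-W₂ (z 3F) y)) (lemma (W₂ (z 3F) y) (z 3F y)))
    where
    lemma : ∀ a b → 1ℤ * (1ℤ * a + 1ℤ * b) + -1ℤ * b ≡ a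
    lemma = solve-∀

  x-suc : ∀ i y → x (suc i) y ≡ 1ℤ * W₃ (z (suc i)) y + -1ℤ * z 0F y
  x-suc i y = trans (sym (z≗ (suc i) y)) (lap-suc z i y)

  x₀ : ∀ y → x 0F y ≡ 1ℤ * (+ 3 * z 0F y + -1ℤ * z 1F y) + -1ℤ * (1ℤ * z 2F y + 1ℤ * z 3F y)
  x₀ y = trans (sym (z≗ 0F y)) (lemma (z 0F y) (z 1F y) (z 2F y) (z 3F y))
    where
    lemma : ∀ a b c d → + 3 * a - b - c - d ≡ 1ℤ * (+ 3 * a + -1ℤ * b) + -1ℤ * (1ℤ * c + 1ℤ * d)
    lemma = solve-∀

  W₃x₀ : ∀ {y} → W₃ (x 0F) y ≡
    1ℤ * (+ 3 * W₃ (z 0F) y + -1ℤ * W₃ (z 1F) y) + -1ℤ * (1ℤ * W₃ (z 2F) y + 1ℤ * W₃ (z 3F) y)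
  W₃x₀ {y} = trans
    (W-linear (+ 3) 1ℤ -1ℤ (λ y → + 3 * z 0F y + -1ℤ * z 1F y) (λ y → 1ℤ * z 2F y + 1ℤ * z 3F y) x₀ y)
    (cong₂ (λ u v → 1ℤ * u + -1ℤ * v)
      (W-linear (+ 3) (+ 3) -1ℤ (z 0F) (z 1F) (λ _ → refl) y)
      (W-linear (+ 3) 1ℤ 1ℤ (z 2F) (z 3F) (λ _ → refl) y))

  W₃x₃ : ∀ {y} → W₃ (x 3F) y ≡ 1ℤ * W₃ (W₃ (z 3F)) y + -1ℤ * W₃ (z 0F) y
  W₃x₃ {y} = W-linear (+ 3) 1ℤ -1ℤ (W₃ (z 3F)) (z 0F) (x-suc 2F) y

  lemma : ∀ w₀ w₁ w₂ w₃ w₃₃ z₀ → + 3 * (1ℤ * w₃₃ + -1ℤ * w₃) ≡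
    (1ℤ * (+ 3 * w₀ + -1ℤ * w₁) + -1ℤ * (1ℤ * w₂ + 1ℤ * w₃))
    + (1ℤ * w₁ + -1ℤ * z₀) + (1ℤ * w₂ + -1ℤ * z₀)
    + (+ 3 * (1ℤ * w₃₃ + -1ℤ * w₀) - + 2 * (1ℤ * w₃ + -1ℤ * z₀))
  lemma = solve-∀

branch∧stem⇒InImage : ∀ {m} {x : C (suc m)} →
  InW (+ 3) (branch x) → In3W₃W₂ (stem x) → InImage (suc m) x
branch∧stem⇒InImage {m} {x} (v , v≗) (u , u≗) = z , correct
  where
  -- With z₃ = `u`, block row 3 forces z₀, the branch equation suggests z₂ - z₃ = `v`, and block row
  -- 0 forces z₁. Block row 1 is what remains, and it amounts to the stem equation.
  z₀ z₁ z₂ : Fin (suc m) → ℤ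
  z₀ y = 1ℤ * W₃ u y + -1ℤ * x 3F y
  z₂ y = 1ℤ * u y + 1ℤ * v y
  z₁ y = 1ℤ * (+ 3 * z₀ y + -1ℤ * z₂ y) + -1ℤ * (1ℤ * u y + 1ℤ * x 0F y)

  z : C (suc m)
  z 0F = z₀
  z 1F = z₁
  z 2F = z₂
  z 3F = u

  W₃z₀ : ∀ y → W₃ z₀ y ≡ 1ℤ * W₃ (W₃ u) y + -1ℤ * W₃ (x 3F) y
  W₃z₀ = W-linear (+ 3) 1ℤ -1ℤ (W₃ u) (x 3F) (λ _ → refl)

  W₃z₂ : ∀ y → W₃ z₂ y ≡ 1ℤ * W₃ u y + 1ℤ * branch x y
  W₃z₂ y = trans (W-linear (+ 3) 1ℤ 1ℤ u v (λ _ → refl) y)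
    (cong (λ r → 1ℤ * W₃ u y + 1ℤ * r) (v≗ y))

  W₃z₁ : ∀ y → W₃ z₁ y ≡
    1ℤ * (+ 3 * W₃ z₀ y + -1ℤ * W₃ z₂ y) + -1ℤ * (1ℤ * W₃ u y + 1ℤ * W₃ (x 0F) y)
  W₃z₁ y = trans
    (W-linear (+ 3) 1ℤ -1ℤ (λ y → + 3 * z₀ y + -1ℤ * z₂ y) (λ y → 1ℤ * u y + 1ℤ * x 0F y) (λ _ → refl) y)
    (cong₂ (λ u v → 1ℤ * u + -1ℤ * v)
      (W-linear (+ 3) (+ 3) -1ℤ z₀ z₂ (λ _ → refl) y)
      (W-linear (+ 3) 1ℤ 1ℤ u (x 0F) (λ _ → refl) y))

  3W₃W₃u : ∀ y → + 3 * W₃ (W₃ u) y ≡ 1ℤ * stem x y + + 3 * W₃ u y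
  3W₃W₃u y = begin
    + 3 * W₃ (W₃ u) y                          ≡⟨ cong (λ r → + 3 * r) (W-linear (+ 3) 1ℤ 1ℤ (W₂ u) u (W₃-W₂ u) y) ⟩
    + 3 * (1ℤ * W₃ (W₂ u) y + 1ℤ * W₃ u y)     ≡⟨ lemma (W₃ (W₂ u) y) (W₃ u y) ⟩
    1ℤ * (+ 3 * W₃ (W₂ u) y) + + 3 * W₃ u y    ≡⟨ cong (λ r → 1ℤ * r + + 3 * W₃ u y) (u≗ y) ⟩
    1ℤ * stem x y + + 3 * W₃ u y               ∎
    where
    lemma : ∀ a b → + 3 * (1ℤ * a + 1ℤ * b) ≡ 1ℤ * (+ 3 * a) + + 3 * b
    lemma = solve-∀

  correct : ∀ i y → lap z i y ≡ x i y
  correct 0F y = lemma (z₀ y) (z₂ y) (u y) (x 0F y)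
    where
    lemma : ∀ a b c x → + 3 * a - (1ℤ * (+ 3 * a + -1ℤ * b) + -1ℤ * (1ℤ * c + 1ℤ * x)) - b - c ≡ x
    lemma = solve-∀
  correct 1F y = begin
    lap z 1F y
      ≡⟨ lap-suc z 0F y ⟩
    1ℤ * W₃ z₁ y + -1ℤ * z₀ y
      ≡⟨ cong (λ r → 1ℤ * r + -1ℤ * z₀ y) (trans (W₃z₁ y)
           (cong₂ (λ r s → 1ℤ * (+ 3 * r + -1ℤ * s) + -1ℤ * (1ℤ * W₃ u y + 1ℤ * W₃ (x 0F) y))
             (W₃z₀ y) (W₃z₂ y))) ⟩
    1ℤ * (1ℤ * (+ 3 * (1ℤ * W₃ (W₃ u) y + -1ℤ * W₃ (x 3F) y) + -1ℤ * (1ℤ * W₃ u y + 1ℤ * branch x y))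
      + -1ℤ * (1ℤ * W₃ u y + 1ℤ * W₃ (x 0F) y)) + -1ℤ * z₀ y
      ≡⟨ gather (W₃ (W₃ u) y) (W₃ (x 3F) y) (W₃ u y) (branch x y) (W₃ (x 0F) y) (x 3F y) ⟩
    + 3 * W₃ (W₃ u) y
      + (x 3F y - + 3 * W₃ (x 3F) y - + 3 * W₃ u y - branch x y - W₃ (x 0F) y)
      ≡⟨ cong (_+ (x 3F y - + 3 * W₃ (x 3F) y - + 3 * W₃ u y - branch x y - W₃ (x 0F) y)) (3W₃W₃u y) ⟩
    1ℤ * stem x y + + 3 * W₃ u y
      + (x 3F y - + 3 * W₃ (x 3F) y - + 3 * W₃ u y - branch x y - W₃ (x 0F) y)
      ≡⟨ cancel (W₃ (x 0F) y) (x 1F y) (x 2F y) (W₃ (x 3F) y) (x 3F y) (W₃ u y) ⟩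
    x 1F y ∎
    where
    gather : ∀ uu w₃ u b w₀ x₃ →
      1ℤ * (1ℤ * (+ 3 * (1ℤ * uu + -1ℤ * w₃) + -1ℤ * (1ℤ * u + 1ℤ * b))
        + -1ℤ * (1ℤ * u + 1ℤ * w₀)) + -1ℤ * (1ℤ * u + -1ℤ * x₃) ≡
      + 3 * uu + (x₃ - + 3 * w₃ - + 3 * u - b - w₀)
    gather = solve-∀
    cancel : ∀ w₀ x₁ x₂ w₃ x₃ u →
      1ℤ * (w₀ + x₁ + x₂ + (+ 3 * w₃ - + 2 * x₃)) + + 3 * u
        + (x₃ - + 3 * w₃ - + 3 * u - (x₂ - x₃) - w₀) ≡ x₁
    cancel = solve-∀
  correct 2F y = begin
    lap z 2F y                                          ≡⟨ lap-suc z 1F y ⟩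
    1ℤ * W₃ z₂ y + -1ℤ * z₀ y                         ≡⟨ cong (λ r → 1ℤ * r + -1ℤ * z₀ y) (W₃z₂ y) ⟩
    1ℤ * (1ℤ * W₃ u y + 1ℤ * branch x y) + -1ℤ * z₀ y   ≡⟨ lemma (W₃ u y) (x 2F y) (x 3F y) ⟩
    x 2F y                                              ∎
    where
    lemma : ∀ u x₂ x₃ → 1ℤ * (1ℤ * u + 1ℤ * (x₂ - x₃)) + -1ℤ * (1ℤ * u + -1ℤ * x₃) ≡ x₂
    lemma = solve-∀
  correct 3F y = trans (lap-suc z 2F y) (lemma (W₃ u y) (x 3F y))
    where
    lemma : ∀ u x → 1ℤ * u + -1ℤ * (1ℤ * u + -1ℤ * x) ≡ x
    lemma = solve-∀

-- Unimodularity of the four solution sequences on the lowest entries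

•-low-high : ∀ {k} s (x : Fin (4 ℕ.+ k) → ℤ) →
  on s • x ≡ s 0 * x 0F + s 1 * x 1F + s 2 * x 2F + s 3 * x 3F
             + on (λ a → s (4 ℕ.+ a)) • (λ j → x (suc (suc (suc (suc j)))))
•-low-high s x = lemma (s 0 * x 0F) (s 1 * x 1F) (s 2 * x 2F) (s 3 * x 3F)
  (on (λ a → s (4 ℕ.+ a)) • (λ j → x (suc (suc (suc (suc j))))))
  where
  lemma : ∀ a b c d r → a + (b + (c + (d + r))) ≡ a + b + c + d + r
  lemma = solve-∀

InitialValues : (ℕ → ℤ) → ℤ → ℤ → ℤ → ℤ → Set
InitialValues s c₀ c₁ c₂ c₃ = s 0 ≡ c₀ × s 1 ≡ c₁ × s 2 ≡ c₂ × s 3 ≡ c₃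

one : ℕ → ℤ
one _ = 1ℤ

ι : ℕ → ℤ
ι a = + a

one-initial : InitialValues one 1ℤ 1ℤ 1ℤ 1ℤ
one-initial = refl , refl , refl , refl

ι-initial : InitialValues ι 0ℤ 1ℤ (+ 2) (+ 3)
ι-initial = refl , refl , refl , refl

F₂-initial : InitialValues F₂ 0ℤ 1ℤ (+ 3) (+ 8)
F₂-initial = refl , refl , refl , refl

L₂-initial : InitialValues L₂ -1ℤ 1ℤ (+ 4) (+ 11)
L₂-initial = refl , refl , refl , refl

∣-low-part : ∀ {k d} s c₀ c₁ c₂ c₃ (x : Fin (4 ℕ.+ k) → ℤ) → InitialValues s c₀ c₁ c₂ c₃ →
  d ∣ on s • x → (∀ j → d ∣ x (suc (suc (suc (suc j))))) →
  d ∣ c₀ * x 0F + c₁ * x 1F + c₂ * x 2F + c₃ * x 3F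
∣-low-part {d = d} s _ _ _ _ x (refl , refl , refl , refl) d∣s•x d∣x =
  ∣m+n∣n⇒∣m {m = s 0 * x 0F + s 1 * x 1F + s 2 * x 2F + s 3 * x 3F}
    (subst (d ∣_) (•-low-high s x) d∣s•x)
    (∣-•ʳ (on (λ a → s (4 ℕ.+ a))) (λ j → x (suc (suc (suc (suc j))))) d∣x)

-- The coefficients a, b, c, e below form the inverse of the unimodular matrix of the values of
-- one, ι, F₂, L₂ at 0, 1, 2, 3.
∣-all : ∀ {k d} (x : Fin (4 ℕ.+ k) → ℤ) →
  d ∣ on one • x → d ∣ on ι • x → d ∣ on F₂ • x → d ∣ on L₂ • x →
  (∀ j → d ∣ x (suc (suc (suc (suc j))))) → ∀ y → d ∣ x y
∣-all {d = d} x d∣S d∣M d∣P d∣Q d∣x = λ where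
    0F → combine -[1+ 1 ] 1ℤ (+ 4) -[1+ 2 ] (row₀ (x 0F) (x 1F) (x 2F) (x 3F))
    1F → combine (+ 7) -[1+ 3 ] -[1+ 8 ] (+ 7) (row₁ (x 0F) (x 1F) (x 2F) (x 3F))
    2F → combine -[1+ 4 ] (+ 4) (+ 6) -[1+ 4 ] (row₂ (x 0F) (x 1F) (x 2F) (x 3F))
    3F → combine 1ℤ -1ℤ -1ℤ 1ℤ (row₃ (x 0F) (x 1F) (x 2F) (x 3F))
    (suc (suc (suc (suc j)))) → d∣x j
  where
  combine : ∀ a b c e {u} →
    a * (1ℤ * x 0F + 1ℤ * x 1F + 1ℤ * x 2F + 1ℤ * x 3F)
    + b * (0ℤ * x 0F + 1ℤ * x 1F + + 2 * x 2F + + 3 * x 3F)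
    + c * (0ℤ * x 0F + 1ℤ * x 1F + + 3 * x 2F + + 8 * x 3F)
    + e * (-1ℤ * x 0F + 1ℤ * x 1F + + 4 * x 2F + + 11 * x 3F) ≡ u → d ∣ u
  combine a b c e eq = subst (d ∣_) eq
    (∣m∣n⇒∣m+n (∣m∣n⇒∣m+n (∣m∣n⇒∣m+n
      (∣n⇒∣m*n a (∣-low-part one 1ℤ 1ℤ 1ℤ 1ℤ x one-initial d∣S d∣x))
      (∣n⇒∣m*n b (∣-low-part ι 0ℤ 1ℤ (+ 2) (+ 3) x ι-initial d∣M d∣x)))
      (∣n⇒∣m*n c (∣-low-part F₂ 0ℤ 1ℤ (+ 3) (+ 8) x F₂-initial d∣P d∣x)))
      (∣n⇒∣m*n e (∣-low-part L₂ -1ℤ 1ℤ (+ 4) (+ 11) x L₂-initial d∣Q d∣x)))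

  row₀ : ∀ x₀ x₁ x₂ x₃ →
    -[1+ 1 ] * (1ℤ * x₀ + 1ℤ * x₁ + 1ℤ * x₂ + 1ℤ * x₃)
    + 1ℤ * (0ℤ * x₀ + 1ℤ * x₁ + + 2 * x₂ + + 3 * x₃)
    + + 4 * (0ℤ * x₀ + 1ℤ * x₁ + + 3 * x₂ + + 8 * x₃)
    + -[1+ 2 ] * (-1ℤ * x₀ + 1ℤ * x₁ + + 4 * x₂ + + 11 * x₃) ≡ x₀
  row₀ = solve-∀
  row₁ : ∀ x₀ x₁ x₂ x₃ →
    + 7 * (1ℤ * x₀ + 1ℤ * x₁ + 1ℤ * x₂ + 1ℤ * x₃)
    + -[1+ 3 ] * (0ℤ * x₀ + 1ℤ * x₁ + + 2 * x₂ + + 3 * x₃)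
    + -[1+ 8 ] * (0ℤ * x₀ + 1ℤ * x₁ + + 3 * x₂ + + 8 * x₃)
    + + 7 * (-1ℤ * x₀ + 1ℤ * x₁ + + 4 * x₂ + + 11 * x₃) ≡ x₁
  row₁ = solve-∀
  row₂ : ∀ x₀ x₁ x₂ x₃ →
    -[1+ 4 ] * (1ℤ * x₀ + 1ℤ * x₁ + 1ℤ * x₂ + 1ℤ * x₃)
    + + 4 * (0ℤ * x₀ + 1ℤ * x₁ + + 2 * x₂ + + 3 * x₃)
    + + 6 * (0ℤ * x₀ + 1ℤ * x₁ + + 3 * x₂ + + 8 * x₃)
    + -[1+ 4 ] * (-1ℤ * x₀ + 1ℤ * x₁ + + 4 * x₂ + + 11 * x₃) ≡ x₂
  row₂ = solve-∀
  row₃ : ∀ x₀ x₁ x₂ x₃ →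
    1ℤ * (1ℤ * x₀ + 1ℤ * x₁ + 1ℤ * x₂ + 1ℤ * x₃)
    + -1ℤ * (0ℤ * x₀ + 1ℤ * x₁ + + 2 * x₂ + + 3 * x₃)
    + -1ℤ * (0ℤ * x₀ + 1ℤ * x₁ + + 3 * x₂ + + 8 * x₃)
    + 1ℤ * (-1ℤ * x₀ + 1ℤ * x₁ + + 4 * x₂ + + 11 * x₃) ≡ x₃
  row₃ = solve-∀

extend : ∀ {k} → ℤ → ℤ → ℤ → ℤ → (Fin k → ℤ) → Fin (4 ℕ.+ k) → ℤ
extend x₀ x₁ x₂ x₃ high 0F = x₀
extend x₀ x₁ x₂ x₃ high 1F = x₁
extend x₀ x₁ x₂ x₃ high 2F = x₂
extend x₀ x₁ x₂ x₃ high 3F = x₃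
extend x₀ x₁ x₂ x₃ high (suc (suc (suc (suc j)))) = high j

deficit : ∀ {k} → (Fin k → ℤ) → (ℕ → ℤ) → ℤ → ℤ
deficit high s target = target - on (λ a → s (4 ℕ.+ a)) • high

•-extend : ∀ {k} s c₀ c₁ c₂ c₃ x₀ x₁ x₂ x₃ (high : Fin k → ℤ) target → InitialValues s c₀ c₁ c₂ c₃ →
  c₀ * x₀ + c₁ * x₁ + c₂ * x₂ + c₃ * x₃ ≡ deficit high s target →
  on s • extend x₀ x₁ x₂ x₃ high ≡ target
•-extend s _ _ _ _ x₀ x₁ x₂ x₃ high target (refl , refl , refl , refl) eq =
  trans (•-low-high s (extend x₀ x₁ x₂ x₃ high))
    (trans (cong (_+ on (λ a → s (4 ℕ.+ a)) • high) eq)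
           (lemma target (on (λ a → s (4 ℕ.+ a)) • high)))
  where
  lemma : ∀ a r → a - r + r ≡ a
  lemma = solve-∀

record Interpolant {k : ℕ} (high : Fin k → ℤ) (S M P Q : ℤ) : Set where
  field
    x     : Fin (4 ℕ.+ k) → ℤ
    one•x : on one • x ≡ S
    ι•x   : on ι • x ≡ M
    F₂•x  : on F₂ • x ≡ P
    L₂•x  : on L₂ • x ≡ Q
    x≡high : ∀ j → x (suc (suc (suc (suc j)))) ≡ high j

-- The high entries are free, and the four low ones solve a linear system whose inverse is integral.
-- The integrality is comaximality again: since W₃ - W₂ = 1, the powers 1, T, T², T³ form a basis of
-- the product of the quotients of ℤ[T] by T² - 2T + 1 and T² - 3T + 1.
interpolate : ∀ {k} (high : Fin k → ℤ) S M P Q → Interpolant high S M P Q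
interpolate high S M P Q = record
  { x = extend x₀ x₁ x₂ x₃ high
  ; one•x = •-extend one 1ℤ 1ℤ 1ℤ 1ℤ x₀ x₁ x₂ x₃ high S one-initial
      (row₀ (deficit high one S) (deficit high ι M) (deficit high F₂ P) (deficit high L₂ Q))
  ; ι•x = •-extend ι 0ℤ 1ℤ (+ 2) (+ 3) x₀ x₁ x₂ x₃ high M ι-initial
      (row₁ (deficit high one S) (deficit high ι M) (deficit high F₂ P) (deficit high L₂ Q))
  ; F₂•x = •-extend F₂ 0ℤ 1ℤ (+ 3) (+ 8) x₀ x₁ x₂ x₃ high P F₂-initial
      (row₂ (deficit high one S) (deficit high ι M) (deficit high F₂ P) (deficit high L₂ Q))
  ; L₂•x = •-extend L₂ -1ℤ 1ℤ (+ 4) (+ 11) x₀ x₁ x₂ x₃ high Q L₂-initial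
      (row₃ (deficit high one S) (deficit high ι M) (deficit high F₂ P) (deficit high L₂ Q))
  ; x≡high = λ _ → refl
  }
  where
  x₀ x₁ x₂ x₃ : ℤ
  x₀ = -[1+ 1 ] * deficit high one S + 1ℤ * deficit high ι M + + 4 * deficit high F₂ P + -[1+ 2 ] * deficit high L₂ Q
  x₁ = + 7 * deficit high one S + -[1+ 3 ] * deficit high ι M + -[1+ 8 ] * deficit high F₂ P + + 7 * deficit high L₂ Q
  x₂ = -[1+ 4 ] * deficit high one S + + 4 * deficit high ι M + + 6 * deficit high F₂ P + -[1+ 4 ] * deficit high L₂ Q
  x₃ = 1ℤ * deficit high one S + -1ℤ * deficit high ι M + -1ℤ * deficit high F₂ P + 1ℤ * deficit high L₂ Q

  row₀ : ∀ S M P Q →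
    1ℤ * (-[1+ 1 ] * S + 1ℤ * M + + 4 * P + -[1+ 2 ] * Q)
    + 1ℤ * (+ 7 * S + -[1+ 3 ] * M + -[1+ 8 ] * P + + 7 * Q)
    + 1ℤ * (-[1+ 4 ] * S + + 4 * M + + 6 * P + -[1+ 4 ] * Q)
    + 1ℤ * (1ℤ * S + -1ℤ * M + -1ℤ * P + 1ℤ * Q) ≡ S
  row₀ = solve-∀

  row₁ : ∀ S M P Q →
    0ℤ * (-[1+ 1 ] * S + 1ℤ * M + + 4 * P + -[1+ 2 ] * Q)
    + 1ℤ * (+ 7 * S + -[1+ 3 ] * M + -[1+ 8 ] * P + + 7 * Q)
    + + 2 * (-[1+ 4 ] * S + + 4 * M + + 6 * P + -[1+ 4 ] * Q)
    + + 3 * (1ℤ * S + -1ℤ * M + -1ℤ * P + 1ℤ * Q) ≡ M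
  row₁ = solve-∀

  row₂ : ∀ S M P Q →
    0ℤ * (-[1+ 1 ] * S + 1ℤ * M + + 4 * P + -[1+ 2 ] * Q)
    + 1ℤ * (+ 7 * S + -[1+ 3 ] * M + -[1+ 8 ] * P + + 7 * Q)
    + + 3 * (-[1+ 4 ] * S + + 4 * M + + 6 * P + -[1+ 4 ] * Q)
    + + 8 * (1ℤ * S + -1ℤ * M + -1ℤ * P + 1ℤ * Q) ≡ P
  row₂ = solve-∀

  row₃ : ∀ S M P Q →
    -1ℤ * (-[1+ 1 ] * S + 1ℤ * M + + 4 * P + -[1+ 2 ] * Q)
    + 1ℤ * (+ 7 * S + -[1+ 3 ] * M + -[1+ 8 ] * P + + 7 * Q)
    + + 4 * (-[1+ 4 ] * S + + 4 * M + + 6 * P + -[1+ 4 ] * Q)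
    + + 11 * (1ℤ * S + -1ℤ * M + -1ℤ * P + 1ℤ * Q) ≡ Q
  row₃ = solve-∀

-- Coordinates on the cokernel

data Main : Set where
  slope branchF branchL stemF stemL : Main

Coordinate : ℕ → Set
Coordinate k = Fin k ⊎ Main

main-modulus : ℕ → ℕ → ℕ → Main → ℕ
main-modulus k d e slope   = 3 ℕ.* (4 ℕ.+ k)
main-modulus k d e branchF = d
main-modulus k d e branchL = e
main-modulus k d e stemF   = 3 ℕ.* d
main-modulus k d e stemL   = 3 ℕ.* e

modulus : ∀ {k} → ℕ → ℕ → Coordinate k → ℕ
modulus {k} d e = [ (λ _ → 3) , main-modulus k d e ]′

value : ∀ {k} → Coordinate k → C (4 ℕ.+ k) → ℤ
value (inj₁ j)       x = stem x (suc (suc (suc (suc j))))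
value (inj₂ slope)   x = on ι • stem x
value (inj₂ branchF) x = on F₂ • branch x
value (inj₂ branchL) x = on L₂ • branch x
value (inj₂ stemF)   x = on F₂ • stem x
value (inj₂ stemL)   x = on L₂ • stem x

degree : ∀ {m} → C (suc m) → ℤ
degree x = on one • stem x

degree-linear : ∀ {m} a b (v w : C (suc m)) {x : C (suc m)} →
  (∀ i y → x i y ≡ a * v i y + b * w i y) → degree x ≡ a * degree v + b * degree w
degree-linear a b v w x≗ = •-linear a b (on one) (stem v) (stem w) (stem-linear a b v w x≗)

value-linear : ∀ {k} (j : Coordinate k) a b (v w : C (4 ℕ.+ k)) {x : C (4 ℕ.+ k)} →
  (∀ i y → x i y ≡ a * v i y + b * w i y) → value j x ≡ a * value j v + b * value j w
value-linear (inj₁ j) a b v w x≗ = stem-linear a b v w x≗ _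
value-linear (inj₂ slope)   a b v w x≗ = •-linear a b (on ι) (stem v) (stem w) (stem-linear a b v w x≗)
value-linear (inj₂ branchF) a b v w x≗ = •-linear a b (on F₂) (branch v) (branch w) (branch-linear a b v w x≗)
value-linear (inj₂ branchL) a b v w x≗ = •-linear a b (on L₂) (branch v) (branch w) (branch-linear a b v w x≗)
value-linear (inj₂ stemF)   a b v w x≗ = •-linear a b (on F₂) (stem v) (stem w) (stem-linear a b v w x≗)
value-linear (inj₂ stemL)   a b v w x≗ = •-linear a b (on L₂) (stem v) (stem w) (stem-linear a b v w x≗)

value-surjective : ∀ {k} (t : Coordinate k → ℤ) →
  Σ (C (4 ℕ.+ k)) λ x → degree x ≡ 0ℤ × ∀ j → value j x ≡ t j
value-surjective {k} t = x , trans (•-cong (on one) stem≗) s.one•x , λ where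
    (inj₁ j)       → trans (stem≗ _) (s.x≡high j)
    (inj₂ slope)   → trans (•-cong (on ι) stem≗) s.ι•x
    (inj₂ branchF) → trans (•-cong (on F₂) branch≗) b.F₂•x
    (inj₂ branchL) → trans (•-cong (on L₂) branch≗) b.L₂•x
    (inj₂ stemF)   → trans (•-cong (on F₂) stem≗) s.F₂•x
    (inj₂ stemL)   → trans (•-cong (on L₂) stem≗) s.L₂•x
  where
  -- The branch is only read through `F₂` and `L₂`, so its other data are set to 0. For the stem,
  -- the sum is set to 0 to make the degree vanish.
  module b = Interpolant (interpolate {k} (λ _ → 0ℤ) 0ℤ 0ℤ (t (inj₂ branchF)) (t (inj₂ branchL)))
  module s = Interpolant
    (interpolate (λ j → t (inj₁ j)) 0ℤ (t (inj₂ slope)) (t (inj₂ stemF)) (t (inj₂ stemL)))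

  -- Supported on x₁ and x₂, such a vector has branch x₂ and stem x₁ + x₂, so both can be prescribed
  -- independently.
  x : C (4 ℕ.+ k)
  x 0F y = 0ℤ
  x 1F y = s.x y - b.x y
  x 2F y = b.x y
  x 3F y = 0ℤ

  branch≗ : ∀ y → branch x y ≡ b.x y
  branch≗ y = ℤₚ.+-identityʳ (b.x y)

  stem≗ : ∀ y → stem x y ≡ s.x y
  stem≗ y = lemma (s.x y) (b.x y)
    where
    lemma : ∀ s b → 0ℤ + (s - b) + b + 0ℤ ≡ s
    lemma = solve-∀

-- The image of the Laplacian in terms of coordinates

quotients : ∀ {n d} (v : Fin n → ℤ) → (∀ y → d ∣ v y) →
  Σ (Fin n → ℤ) λ w → ∀ y → v y ≡ d * w y
quotients {d = d} v d∣v = (λ y → quotient (d∣v y)) , λ y →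
  trans (_∣_.equality (d∣v y)) (ℤₚ.*-comm (quotient (d∣v y)) d)

module _ {k d e : ℕ} (Δ : Diagonalisation (+ 3) (4 ℕ.+ k) F₂ L₂ (+ d) (+ e)) where

  private
    Δ₂ : Diagonalisation (+ 2) (4 ℕ.+ k) ι one (+ (4 ℕ.+ k)) 0ℤ
    Δ₂ = linear-diagonalisation (4 ℕ.+ k)

    triple : ∀ a x y → x ≡ + 3 * y → + a ∣ y → + (3 ℕ.* a) ∣ x
    triple a x y x≡ a∣y = subst (_∣ x) (sym (ℤₚ.pos-* 3 a))
      (subst (+ 3 * + a ∣_) (sym x≡) (*-monoʳ-∣ (+ 3) {+ a} {y} a∣y))

    untriple : ∀ a x y → x ≡ + 3 * y → + (3 ℕ.* a) ∣ x → + a ∣ y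
    untriple a x y x≡ 3a∣x = *-cancelˡ-∣ (+ 3) {+ a} {y}
      (subst (+ 3 * + a ∣_) x≡ (subst (_∣ x) (ℤₚ.pos-* 3 a) 3a∣x))

    3∣triple : ∀ a x → + (3 ℕ.* a) ∣ x → + 3 ∣ x
    3∣triple a x 3a∣x = ∣-trans (subst (+ 3 ∣_) (sym (ℤₚ.pos-* 3 a)) (∣m⇒∣m*n {m = + 3} (+ a) ∣-refl)) 3a∣x

  InImage⇒value : ∀ {x} → InImage (4 ℕ.+ k) x → degree x ≡ 0ℤ × ∀ j → + modulus d e j ∣ value j x
  InImage⇒value {x} x∈ = degree≡0 , λ where
      (inj₁ j)       → subst (+ 3 ∣_) (stem≗ (suc (suc (suc (suc j)))))
                         (∣m⇒∣m*n {m = + 3} (W₃ (W₂ u) (suc (suc (suc (suc j))))) ∣-refl)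
      (inj₂ slope)   → triple (4 ℕ.+ k) (on ι • stem x) (on ι • W₃ (W₂ u)) (scaled ι) (proj₁ (InW⇒∣ Δ₂ {W₃ (W₂ u)} ∈W₂))
      (inj₂ branchF) → proj₁ (InW⇒∣ Δ {branch x} (InImage⇒branch {x = x} x∈))
      (inj₂ branchL) → proj₂ (InW⇒∣ Δ {branch x} (InImage⇒branch {x = x} x∈))
      (inj₂ stemF)   → triple d (on F₂ • stem x) (on F₂ • W₃ (W₂ u)) (scaled F₂) (proj₁ (InW⇒∣ Δ {W₃ (W₂ u)} ∈W₃))
      (inj₂ stemL)   → triple e (on L₂ • stem x) (on L₂ • W₃ (W₂ u)) (scaled L₂) (proj₂ (InW⇒∣ Δ {W₃ (W₂ u)} ∈W₃))
    where
    open In3W₃W₂ (InImage⇒stem {x = x} x∈) renaming (source to u; image to stem≗)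

    ∈W₃ : InW (+ 3) (W₃ (W₂ u))
    ∈W₃ = W₂ u , λ _ → refl

    ∈W₂ : InW (+ 2) (W₃ (W₂ u))
    ∈W₂ = W₃ u , λ y → sym (W₃W₂≗W₂W₃ u y)

    scaled : ∀ s → on s • stem x ≡ + 3 * on s • W₃ (W₂ u)
    scaled s = •-scale (+ 3) (on s) (W₃ (W₂ u)) (λ y → sym (stem≗ y))

    degree≡0 : degree x ≡ 0ℤ
    degree≡0 = trans (scaled one) (cong (λ r → + 3 * r) (0∣⇒≡0 (proj₂ (InW⇒∣ Δ₂ {W₃ (W₂ u)} ∈W₂))))

  private
    -- Dividing by 3 turns the tripled moduli into the criteria for `w` to lie in the images of W₂
    -- and of W₃; comaximality puts it in the image of the product.
    thirds∈3W₃W₂ : ∀ {v} (w : Fin (4 ℕ.+ k) → ℤ) → (∀ y → v y ≡ + 3 * w y) → on one • v ≡ 0ℤ →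
      + (3 ℕ.* (4 ℕ.+ k)) ∣ on ι • v → + (3 ℕ.* d) ∣ on F₂ • v → + (3 ℕ.* e) ∣ on L₂ • v →
      In3W₃W₂ v
    thirds∈3W₃W₂ {v} w v≗ S M P Q =
      proj₁ preimage , λ y → trans (cong (λ r → + 3 * r) (proj₂ preimage y)) (sym (v≗ y))
      where
      scaled : ∀ s → on s • v ≡ + 3 * on s • w
      scaled s = •-scale (+ 3) (on s) w v≗

      preimage : Σ (Fin (4 ℕ.+ k) → ℤ) λ u → ∀ y → W₃ (W₂ u) y ≡ w y
      preimage = W₃W₂-surjects
        (∣⇒InW Δ {w} (untriple d (on F₂ • v) (on F₂ • w) (scaled F₂) P)
                     (untriple e (on L₂ • v) (on L₂ • w) (scaled L₂) Q))
        (∣⇒InW Δ₂ {w} (untriple (4 ℕ.+ k) (on ι • v) (on ι • w) (scaled ι) M)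
                      -- Vanishing is read as divisibility by 3 · 0, so the free coordinate is
                      -- divided by 3 like the others.
                      (untriple 0 (on one • v) (on one • w) (scaled one) (divides 0ℤ S)))

  value⇒InImage : ∀ {x} → degree x ≡ 0ℤ → (∀ j → + modulus d e j ∣ value j x) → InImage (4 ℕ.+ k) x
  value⇒InImage {x} degree≡0 ∣value = branch∧stem⇒InImage {x = x}
    (∣⇒InW Δ {branch x} (∣value (inj₂ branchF)) (∣value (inj₂ branchL)))
    (thirds∈3W₃W₂ (proj₁ thirds) (proj₂ thirds)
      degree≡0 (∣value (inj₂ slope)) (∣value (inj₂ stemF)) (∣value (inj₂ stemL)))
    where
    -- This is where the coordinates modulo 3 enter: together with the pairings modulo 3 they make
    -- every entry of the stem divisible by 3.
    thirds : Σ (Fin (4 ℕ.+ k) → ℤ) λ w → ∀ y → stem x y ≡ + 3 * w y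
    thirds = quotients (stem x) (∣-all (stem x) (divides 0ℤ degree≡0)
      (3∣triple (4 ℕ.+ k) (on ι • stem x) (∣value (inj₂ slope)))
      (3∣triple d (on F₂ • stem x) (∣value (inj₂ stemF)))
      (3∣triple e (on L₂ • stem x) (∣value (inj₂ stemL)))
      (λ j → ∣value (inj₁ j)))

-- Matching coordinates with the list of cyclic factors

-- A bijection that carries moduli to list entries. It keeps the order of the factors out of the
-- group theory, so that both parities use one isomorphism.
record Listing {J : Set} (m : J → ℕ) (ds : List ℕ) : Set where
  field
    at          : Fin (length ds) → J
    position    : J → Fin (length ds)
    at-position : ∀ j → at (position j) ≡ j
    position-at : ∀ i → position (at i) ≡ i
    lookup-at   : ∀ i → lookup ds i ≡ m (at i)

replicate-listing : ∀ {J m ds} c k → Listing {J} m ds →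
  Listing {Fin k ⊎ J} [ (λ _ → c) , m ]′ (replicate k c ++ ds)
replicate-listing {J} {m} {ds} c k ℓ = record
  { at = at k ; position = position k ; at-position = at-position k
  ; position-at = position-at k ; lookup-at = lookup-at k }
  where
  module ℓ = Listing ℓ

  Index : ℕ → Set
  Index k = Fin (length (replicate k c ++ ds))

  lift : ∀ {k} → Fin k ⊎ J → Fin (suc k) ⊎ J
  lift (inj₁ i) = inj₁ (suc i)
  lift (inj₂ j) = inj₂ j

  at : ∀ k → Index k → Fin k ⊎ J
  at zero    i       = inj₂ (ℓ.at i)
  at (suc k) zero    = inj₁ zero
  at (suc k) (suc i) = lift (at k i)

  position : ∀ k → Fin k ⊎ J → Index k
  position zero    (inj₂ j)       = ℓ.position j
  position (suc k) (inj₁ zero)    = zero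
  position (suc k) (inj₁ (suc i)) = suc (position k (inj₁ i))
  position (suc k) (inj₂ j)       = suc (position k (inj₂ j))

  at-position : ∀ k j → at k (position k j) ≡ j
  at-position zero    (inj₂ j)       = cong inj₂ (ℓ.at-position j)
  at-position (suc k) (inj₁ zero)    = refl
  at-position (suc k) (inj₁ (suc i)) = cong lift (at-position k (inj₁ i))
  at-position (suc k) (inj₂ j)       = cong lift (at-position k (inj₂ j))

  position-lift : ∀ k j → position (suc k) (lift j) ≡ suc (position k j)
  position-lift k (inj₁ i) = refl
  position-lift k (inj₂ j) = refl

  position-at : ∀ k i → position k (at k i) ≡ i
  position-at zero    i       = ℓ.position-at i
  position-at (suc k) zero    = refl
  position-at (suc k) (suc i) = trans (position-lift k (at k i)) (cong suc (position-at k i))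

  constant-lift : ∀ {k} (j : Fin k ⊎ J) → [ (λ _ → c) , m ]′ j ≡ [ (λ _ → c) , m ]′ (lift j)
  constant-lift (inj₁ i) = refl
  constant-lift (inj₂ j) = refl

  lookup-at : ∀ k i → lookup (replicate k c ++ ds) i ≡ [ (λ _ → c) , m ]′ (at k i)
  lookup-at zero    i       = ℓ.lookup-at i
  lookup-at (suc k) zero    = refl
  lookup-at (suc k) (suc i) = trans (lookup-at k i) (constant-lift (at k i))

-- Torsion classes and the isomorphism

degree-scale : ∀ {m} a (x : C (suc m)) → degree (λ i y → a * x i y) ≡ a * degree x
degree-scale a x = trans
  (degree-linear a 0ℤ x x (λ i y → *-pad a (x i y))) (sym (*-pad a (degree x)))

value-scale : ∀ {k} (j : Coordinate k) a x → value j (λ i y → a * x i y) ≡ a * value j x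
value-scale j a x = trans
  (value-linear j a 0ℤ x x (λ i y → *-pad a (x i y))) (sym (*-pad a (value j x)))

-- The degree vanishes on the image and takes values in the torsion-free group ℤ.
torsion⇒degree≡0 : ∀ {k d e} → Diagonalisation (+ 3) (4 ℕ.+ k) F₂ L₂ (+ d) (+ e) →
  ∀ x → IsTorsion (4 ℕ.+ k) x → degree x ≡ 0ℤ
torsion⇒degree≡0 {k} {d} {e} Δ x (r , 1≤r , rx∈) = ℤₚ.*-cancelˡ-≡ (+ r) (degree x) 0ℤ
  {{ℕ.>-nonZero 1≤r}}
  (begin
    + r * degree x                    ≡⟨ degree-scale (+ r) x ⟨
    degree (λ i y → + r * x i y)      ≡⟨ proj₁ (InImage⇒value {k} {d} {e} Δ {λ i y → + r * x i y} rx∈) ⟩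
    0ℤ                                ≡⟨ ℤₚ.*-zeroʳ (+ r) ⟨
    + r * 0ℤ                          ∎)

module _ {k d e : ℕ} (Δ : Diagonalisation (+ 3) (4 ℕ.+ k) F₂ L₂ (+ d) (+ e))
         (1≤d : 1 ≤ d) (1≤e : 1 ≤ e) where

  private
    n exponent : ℕ
    n = 4 ℕ.+ k
    -- A common multiple of all the moduli; it annihilates every class of degree 0, and it is
    -- positive because `d` and `e` are.
    exponent = 3 ℕ.* (n ℕ.* (d ℕ.* e))

    1≤exponent : 1 ≤ exponent
    1≤exponent = ℕₚ.*-mono-≤ {1} {3} (s≤s z≤n)
      (ℕₚ.*-mono-≤ {1} {n} (s≤s z≤n) (ℕₚ.*-mono-≤ 1≤d 1≤e))

    de∣n*de : (d ℕ.* e) ℕ∣.∣ n ℕ.* (d ℕ.* e)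
    de∣n*de = n∣m*n n

    modulus∣exponent : (j : Coordinate k) → modulus d e j ℕ∣.∣ exponent
    modulus∣exponent (inj₁ j)       = m∣m*n (n ℕ.* (d ℕ.* e))
    modulus∣exponent (inj₂ slope)   = ℕ∣.*-monoʳ-∣ 3 (m∣m*n {n} (d ℕ.* e))
    modulus∣exponent (inj₂ branchF) = ℕ∣.∣-trans (ℕ∣.∣-trans (m∣m*n e) de∣n*de) (n∣m*n 3)
    modulus∣exponent (inj₂ branchL) = ℕ∣.∣-trans (ℕ∣.∣-trans (n∣m*n d) de∣n*de) (n∣m*n 3)
    modulus∣exponent (inj₂ stemF)   = ℕ∣.*-monoʳ-∣ 3 (ℕ∣.∣-trans (m∣m*n {d} e) de∣n*de)
    modulus∣exponent (inj₂ stemL)   = ℕ∣.*-monoʳ-∣ 3 (ℕ∣.∣-trans (n∣m*n d {e}) de∣n*de)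

    as-sum : ∀ a b → a + b ≡ 1ℤ * a + 1ℤ * b
    as-sum = solve-∀

    as-difference : ∀ a b → a - b ≡ 1ℤ * a + -1ℤ * b
    as-difference = solve-∀

    value-difference : ∀ (j : Coordinate k) x x′ →
      value j (λ i y → x i y - x′ i y) ≡ value j x - value j x′
    value-difference j x x′ = trans
      (value-linear j 1ℤ -1ℤ x x′ (λ i y → as-difference (x i y) (x′ i y)))
      (sym (as-difference (value j x) (value j x′)))

    value-sum : ∀ (j : Coordinate k) x x′ x″ → (∀ i y → x″ i y ≡ x i y + x′ i y) →
      value j x″ ≡ value j x + value j x′
    value-sum j x x′ x″ x″≗ = trans
      (value-linear j 1ℤ 1ℤ x x′ (λ i y → trans (x″≗ i y) (as-sum (x i y) (x′ i y))))
      (sym (as-sum (value j x) (value j x′)))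

    degree-difference : ∀ (x x′ : C n) → degree x ≡ 0ℤ → degree x′ ≡ 0ℤ →
      degree (λ i y → x i y - x′ i y) ≡ 0ℤ
    degree-difference x x′ x₀ x′₀ = trans
      (degree-linear 1ℤ -1ℤ x x′ (λ i y → as-difference (x i y) (x′ i y)))
      (cong₂ (λ u v → 1ℤ * u + -1ℤ * v) x₀ x′₀)

    ≡⇒∣- : ∀ m {x y} → x ≡ y → m ∣ x - y
    ≡⇒∣- m {y = y} refl = divides 0ℤ (ℤₚ.+-inverseʳ y)

  -- A class is torsion exactly when its degree vanishes. One direction lets the difference of two
  -- torsion classes meet the criterion for the image; the other makes the class built from
  -- prescribed values a torsion class.
  jacobian : ∀ {ds} → Listing (modulus d e) ds → JacIso n ds
  jacobian {ds} ℓ = record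
    { f = λ a i → value (at i) (proj₁ a)
    ; well-defined = λ a b → well-defined (proj₁ a) (proj₁ b)
    ; homomorphism = λ a b c c≗ i → ∣⇒∣ᵤ {+ lookup ds i} (≡⇒∣- (+ lookup ds i)
        (value-sum (at i) (proj₁ a) (proj₁ b) (proj₁ c) c≗))
    ; injective = λ a b → injective (proj₁ a) (proj₁ b)
        (torsion⇒degree≡0 Δ (proj₁ a) (proj₂ a)) (torsion⇒degree≡0 Δ (proj₁ b) (proj₂ b))
    ; surjective = surjective
    }
    where
    open Listing ℓ

    well-defined : ∀ x x′ → CokerEq n x x′ → CycEq ds (λ i → value (at i) x) (λ i → value (at i) x′)
    well-defined x x′ x~x′ i = ∣⇒∣ᵤ {+ lookup ds i}
      (subst (λ m → + m ∣ value (at i) x - value (at i) x′) (sym (lookup-at i))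
        (subst (+ modulus d e (at i) ∣_) (value-difference (at i) x x′)
          (proj₂ (InImage⇒value Δ {λ i y → x i y - x′ i y} x~x′) (at i))))

    injective : ∀ x x′ → degree x ≡ 0ℤ → degree x′ ≡ 0ℤ →
      CycEq ds (λ i → value (at i) x) (λ i → value (at i) x′) → CokerEq n x x′
    injective x x′ x₀ x′₀ fx≈fx′ = value⇒InImage Δ {λ i y → x i y - x′ i y}
      (degree-difference x x′ x₀ x′₀)
      (λ j → subst (λ j → + modulus d e j ∣ value j (λ i y → x i y - x′ i y)) (at-position j)
        (subst (+ modulus d e (at (position j)) ∣_) (sym (value-difference (at (position j)) x x′))
          (subst (λ m → + m ∣ value (at (position j)) x - value (at (position j)) x′)
            (lookup-at (position j)) (∣ᵤ⇒∣ {+ lookup ds (position j)} (fx≈fx′ (position j))))))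

    torsion : ∀ x → degree x ≡ 0ℤ → IsTorsion n x
    torsion x x₀ = exponent , 1≤exponent , value⇒InImage Δ {λ i y → + exponent * x i y}
      (trans (degree-scale (+ exponent) x)
        (trans (cong (λ r → + exponent * r) x₀) (ℤₚ.*-zeroʳ (+ exponent))))
      (λ j → subst (+ modulus d e j ∣_) (sym (value-scale j (+ exponent) x))
        (∣m⇒∣m*n {m = + exponent} (value j x) (∣ᵤ⇒∣ {+ modulus d e j} (modulus∣exponent j))))

    surjective : ∀ t → Σ (Jac n) λ a → CycEq ds (λ i → value (at i) (proj₁ a)) t
    surjective t =
      (proj₁ lifted , torsion (proj₁ lifted) (proj₁ (proj₂ lifted))) ,
      λ i → ∣⇒∣ᵤ {+ lookup ds i} (≡⇒∣- (+ lookup ds i)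
        (trans (proj₂ (proj₂ lifted) (at i)) (cong t (position-at i))))
      where
      lifted : Σ (C n) λ x → degree x ≡ 0ℤ × ∀ j → value j x ≡ t (position j)
      lifted = value-surjective (λ j → t (position j))

-- The two parities

F-positive : ∀ a → 1 ≤ F (suc a)
F-positive zero    = s≤s z≤n
F-positive (suc a) = ℕₚ.≤-trans (F-positive a) (ℕₚ.m≤m+n _ _)

Luc-positive : ∀ a → 1 ≤ Luc a
Luc-positive zero          = s≤s z≤n
Luc-positive (suc zero)    = s≤s z≤n
Luc-positive (suc (suc a)) = ℕₚ.≤-trans (Luc-positive (suc a)) (ℕₚ.m≤m+n _ _)

odd-listing : ∀ k d → Listing (main-modulus k d d)
  (3 ℕ.* (4 ℕ.+ k) ∷ d ∷ d ∷ 3 ℕ.* d ∷ 3 ℕ.* d ∷ [])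
odd-listing k d = record
  { at = λ { 0F → slope ; 1F → branchF ; 2F → branchL ; 3F → stemF ; 4F → stemL }
  ; position = λ { slope → 0F ; branchF → 1F ; branchL → 2F ; stemF → 3F ; stemL → 4F }
  ; at-position = λ { slope → refl ; branchF → refl ; branchL → refl ; stemF → refl ; stemL → refl }
  ; position-at = λ { 0F → refl ; 1F → refl ; 2F → refl ; 3F → refl ; 4F → refl }
  ; lookup-at = λ { 0F → refl ; 1F → refl ; 2F → refl ; 3F → refl ; 4F → refl }
  }

even-listing : ∀ k d → Listing (main-modulus k d (5 ℕ.* d))
  (3 ℕ.* (4 ℕ.+ k) ∷ d ∷ 3 ℕ.* d ∷ 5 ℕ.* d ∷ 15 ℕ.* d ∷ [])
even-listing k d = record
  { at = λ { 0F → slope ; 1F → branchF ; 2F → stemF ; 3F → branchL ; 4F → stemL }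
  ; position = λ { slope → 0F ; branchF → 1F ; stemF → 2F ; branchL → 3F ; stemL → 4F }
  ; at-position = λ { slope → refl ; branchF → refl ; branchL → refl ; stemF → refl ; stemL → refl }
  ; position-at = λ { 0F → refl ; 1F → refl ; 2F → refl ; 3F → refl ; 4F → refl }
  -- The modulus of `stemL` is 3 · (5 · d), whereas the list has 15 · d.
  ; lookup-at = λ { 0F → refl ; 1F → refl ; 2F → refl ; 3F → refl ; 4F → ℕₚ.*-assoc 3 5 d }
  }

theorem2 : (n : ℕ) .{{_ : NonZero n}} → 4 ≤ n →
    ((n % 2 ≡ 1 → JacIso n (oddFactors n)) × (n % 2 ≡ 0 → JacIso n (evenFactors n)))
theorem2 n@(suc (suc (suc (suc k)))) (s≤s (s≤s (s≤s (s≤s z≤n)))) =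
    (λ odd → jacobian (odd-diagonalisation n odd) (Luc-positive n) (Luc-positive n)
      (replicate-listing 3 k (odd-listing k (Luc n))))
  , (λ even → jacobian
      (subst (Diagonalisation (+ 3) n F₂ L₂ (+ F n)) (sym (ℤₚ.pos-* 5 (F n))) (even-diagonalisation n even))
      (F-positive (3 ℕ.+ k)) (ℕₚ.*-mono-≤ {1} {5} (s≤s z≤n) (F-positive (3 ℕ.+ k)))
      (replicate-listing 3 k (even-listing k (F n))))
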